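{- Let $n$ be a positive integer and let $\mathbf{G}=\{G_1,\dots,G_{2n-1}\}$ be a collection of $2n-1$ (not necessarily distinct) bipartite graphs on the same bipartition $V=(X,Y)$ with $|X|=|Y|=n$. If $\delta(G_i)\geq\left\lceil \frac{n}{2}\right\rceil$ for each $i\in[2n-1]$, then one of the following holds: (i) $\mathbf{G}$ contains a transversal isomorphic to a Hamiltonian path, i.e. there is a path $P$ with $V(P)=V$ (so $|E(P)|=2n-1$) and an injection $\phi:E(P)\to[2n-1]$ with $e\in E(G_{\phi(e)})$ for every $e\in E(P)$; (ii) $n$ is even and $G_1=\dots=G_{2n-1}=K_{\frac{n}{2},\frac{n}{2}}\cup K_{\frac{n}{2},\frac{n}{2}}$ (the disjoint union of two complete bipartite graphs $K_{\frac n2,\frac n2}$, each with $\frac n2$ vertices in $X$ and $\frac n2$ vertices in $Y$).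
   Context: $[a]=\{1,\dots,a\}$. $\delta(G)$ is the minimum degree of $G$. For a collection $\mathbf{G}=\{G_1,\dots,G_s\}$ of graphs on a common vertex set $V$ and a graph $H$ with $V(H)\subseteq V$ and $|E(H)|\le s$, $H$ is a $\mathbf{G}$-transversal if $|E(H)|=s$ and there is an injection $\phi:E(H)\to[s]$ with $e\in E(G_{\phi(e)})$ for each $e\in E(H)$. -}

module Defs where

open import Data.Nat using (ℕ; zero; suc; _+_; _*_; _∸_; _≤_; ⌈_/2⌉; _/_)
open import Data.Nat.Divisibility using (_∣_)
open import Data.Bool using (Bool; true; false; if_then_else_)
open import Data.Fin using (Fin; zero; suc; inject₁)
open import Data.Sum using (_⊎_; inj₁; inj₂)
open import Data.Product using (Σ; ∃; _×_; _,_)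
open import Function.Definitions using (Injective)
open import Relation.Binary.PropositionalEquality using (_≡_)

countTrue : ∀ {n} → (Fin n → Bool) → ℕ
countTrue {zero}  p = 0
countTrue {suc n} p = (if p zero then 1 else 0) + countTrue (λ i → p (suc i))

-- A bipartite graph on the fixed bipartition (X , Y) with X = Y = Fin n
-- (as disjoint copies): G x y ≡ true iff x ∈ X is adjacent to y ∈ Y.
BipGraph : ℕ → Set
BipGraph n = Fin n → Fin n → Bool

Vertex : ℕ → Set
Vertex n = Fin n ⊎ Fin n

degX : ∀ {n} → BipGraph n → Fin n → ℕ
degX G x = countTrue (λ y → G x y)

degY : ∀ {n} → BipGraph n → Fin n → ℕ
degY G y = countTrue (λ x → G x y)

MinDegAtLeast : ∀ {n} → BipGraph n → ℕ → Set
MinDegAtLeast {n} G d = (∀ (x : Fin n) → d ≤ degX G x) × (∀ (y : Fin n) → d ≤ degY G y)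

Adj : ∀ {n} → BipGraph n → Vertex n → Vertex n → Bool
Adj G (inj₁ x) (inj₂ y) = G x y
Adj G (inj₂ y) (inj₁ x) = G x y
Adj G (inj₁ _) (inj₁ _) = false
Adj G (inj₂ _) (inj₂ _) = false

eqᵇ : Bool → Bool → Bool
eqᵇ true  b = b
eqᵇ false true = false
eqᵇ false false = true

-- A G-transversal isomorphic to a Hamiltonian path, for a collection
-- G : Fin N → BipGraph n of N graphs.  The path is given by its vertex
-- sequence v₀ … v_N (a bijection Fin (suc N) → V, so V(P) = V), its edges
-- are e_i = v_i v_{i+1} for i : Fin N, and φ : Fin N → Fin N is an
-- injection assigning to edge e_i a colour φ i with e_i ∈ E(G_{φ i}).
HamPathTransversal : ∀ {n N} → (Fin N → BipGraph n) → Set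
HamPathTransversal {n} {N} G =
  Σ (Fin (suc N) → Vertex n) λ v →
  Σ (Fin N → Fin N) λ φ →
    Injective _≡_ _≡_ v
  × (∀ (w : Vertex n) → ∃ λ j → v j ≡ w)
  × Injective _≡_ _≡_ φ
  × (∀ (i : Fin N) → Adj (G (φ i)) (v (inject₁ i)) (v (suc i)) ≡ true)

-- G₁ = … = G_N = K_{n/2,n/2} ∪ K_{n/2,n/2}: there are A ⊆ X and B ⊆ Y with
-- |A| = |B| = n/2 such that every G_i has exactly the edges inside A×B and
-- inside (X∖A)×(Y∖B).
AllExtremal : ∀ {n N} → (Fin N → BipGraph n) → Set
AllExtremal {n} {N} G =
  Σ (Fin n → Bool) λ A →
  Σ (Fin n → Bool) λ B →
    countTrue A ≡ n / 2
  × countTrue B ≡ n / 2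
  × (∀ (i : Fin N) (x y : Fin n) → G i x y ≡ eqᵇ (A x) (B y))

{-# OPTIONS --safe #-}
module Submission where

-- Rotating at the ends of a longest rainbow path works as in an uncoloured graph while two colours
-- are unused, because the two ends can then be linked in different colours.  So one gets a rainbow path
-- missing a single vertex y and a single colour, unless a cycle on half of the vertices splits all graphs.
-- The last colour is won by averaging.  If the complement of x, y carries a rainbow cycle (with one colour
-- unused), then a detour through an edge of the cycle succeeds unless xy has at most n − 2 of the 2n − 1
-- colours; and the same holds if the complement carries only a rainbow path (with two colours unused),
-- since its ends cross and close it to a cycle unless a tie of the degree bounds makes several colours
-- interchangeable.  From the path missing y such a path exists in the complement of z, y for all vertices z
-- opposite to y but at most one, whereas the degrees of y force two of them to be joined to y
-- in at least n − 1 colours ("heavy").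

open import Defs
open import Data.Nat hiding (_≟_; equal)
open import Data.Nat.Properties hiding (_≟_)
open import Data.Nat.Divisibility using (_∣_; divides)
open import Data.Nat.DivMod using (m*n/n≡m)
open import Data.Nat.Solver using (module +-*-Solver)
open import Data.Bool using (Bool; true; false; not; T; _∨_; _∧_)
open import Data.Bool.Properties using (not-involutive)
open import Data.Fin using (Fin; zero; suc; inject₁)
import Data.Fin.Properties as Fin
open import Data.List.Base using (List; []; _∷_; _++_; [_]; map; length; allFin; tabulate)
open import Data.List.Properties using (++-assoc; ++-identityʳ; length-tabulate; length-map; length-++)
open import Data.List.Membership.Propositional using (_∈_)
open import Data.List.Membership.Propositional.Properties using (∈-++⁺ˡ; ∈-++⁺ʳ; ∈-++⁻; ∈-map⁺; ∈-map⁻; ∈-allFin)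
open import Data.List.Relation.Unary.Any using (here; there)
open import Data.List.Relation.Binary.Permutation.Propositional using (_↭_; ↭-refl; ↭-sym; ↭-trans; ↭-reflexive; prep; swap; refl; trans)
open import Data.List.Relation.Binary.Permutation.Propositional.Properties using (++-commutativeMonoid; ∈-resp-↭; shift; ++⁺; ++⁺ˡ; ++⁺ʳ; map⁺; ↭-length)
open import Data.Product using (Σ; ∃; _×_; _,_; proj₁; proj₂)
open import Data.Sum using (_⊎_; inj₁; inj₂)
open import Data.Empty using (⊥; ⊥-elim)
open import Data.Unit using (tt)
open import Function using (_∘_)
open import Function.Definitions using (Injective)
open import Relation.Binary.PropositionalEquality hiding ([_]; trans)
import Relation.Binary.PropositionalEquality as Eq
open import Relation.Nullary using (¬_; does; yes; no)
open import Relation.Nullary.Decidable using (dec-true)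
import Algebra.Solver.CommutativeMonoid as CMSolver

-- The obstacle is the last vertex `y`: crossing two neighbourhoods takes two free colours, and only
-- one is left. Giving up a second vertex `x` buys one back: in the complement of `x`, `y` a
-- Hamiltonian path uses 2n - 3 colours and leaves two, a Hamiltonian cycle leaves one. The price is
-- that both vertices must be put back, with the edge `x y` in the colour of a dropped edge; hence
-- the interest in pairs joined in many colours. The threshold n - 1 is where two counts meet. Such
-- a cycle has 2n - 2 edges, and if its missing colour does not join `x` to `y`, at least 2h ≥ n of
-- them touch a neighbour of `x` in that colour; so n - 1 colours of `x y` cannot all avoid these.
-- On the other hand `y` is joined to an opposite vertex in (2n - 1)h/n ≥ n - 1/2 colours on
-- average, which for n ≥ 3 yields two vertices reaching n - 1; n ≤ 2 is settled directly. The
-- crossing counts on a path missing two vertices have no slack: h + h ≥ n is just enough. Their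
-- equality cases cannot be excluded and are carried along as data, the ties.

# : Bool → ℕ
# true  = 1
# false = 0

-- Counting and double counting over lists.

count : ∀ {A : Set} → (A → Bool) → List A → ℕ
count f []       = 0
count f (x ∷ xs) = # (f x) + count f xs

sumBy : ∀ {A : Set} → (A → ℕ) → List A → ℕ
sumBy f []       = 0
sumBy f (x ∷ xs) = f x + sumBy f xs

module _ {A : Set} where

  count-++ : (f : A → Bool) (xs ys : List A) → count f (xs ++ ys) ≡ count f xs + count f ys
  count-++ f []       ys = refl
  count-++ f (x ∷ xs) ys = Eq.trans (cong (# (f x) +_) (count-++ f xs ys)) (sym (+-assoc (# (f x)) _ _))

  count-↭ : (f : A → Bool) {xs ys : List A} → xs ↭ ys → count f xs ≡ count f ys
  count-↭ f refl        = refl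
  count-↭ f (prep x p)  = cong (# (f x) +_) (count-↭ f p)
  count-↭ f (swap {xs} {ys} x y p) = Eq.trans
    (solve 3 (λ a b c → a :+ (b :+ c) := b :+ (a :+ c)) refl (# (f x)) (# (f y)) (count f xs))
    (cong (λ z → # (f y) + (# (f x) + z)) (count-↭ f p))
    where open +-*-Solver
  count-↭ f (trans p q) = Eq.trans (count-↭ f p) (count-↭ f q)

  -- Used when a cycle is cut open at another edge: one entry leaves the list and another enters,
  -- and neither is counted by `f`.
  count-exchange : (f : A → Bool) {a b : A} → f a ≡ false → f b ≡ false → ∀ xs ys →
    count f (ys ++ b ∷ xs) ≡ count f (xs ++ a ∷ ys)
  count-exchange f {a} {b} fa fb xs ys rewrite count-++ f ys (b ∷ xs) | count-++ f xs (a ∷ ys) | fa | fb = +-comm (count f ys) _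

  count-cong : {f g : A → Bool} → (∀ x → f x ≡ g x) → ∀ xs → count f xs ≡ count g xs
  count-cong eq []       = refl
  count-cong eq (x ∷ xs) = cong₂ _+_ (cong # (eq x)) (count-cong eq xs)

  count-zero : {f : A → Bool} → (∀ x → f x ≡ false) → ∀ xs → count f xs ≡ 0
  count-zero eq []       = refl
  count-zero eq (x ∷ xs) rewrite eq x = count-zero eq xs

  count-pos : (f : A → Bool) (xs : List A) → 1 ≤ count f xs → ∃ λ x → x ∈ xs × f x ≡ true
  count-pos f (x ∷ xs) p with f x in eq
  ... | true  = x , here refl , eq
  ... | false = let y , y∈ , fy = count-pos f xs p in y , there y∈ , fy

  count-∈ : (f : A → Bool) {x : A} {xs : List A} → x ∈ xs → f x ≡ true → 1 ≤ count f xs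
  count-∈ f (here refl) eq rewrite eq = s≤s z≤n
  count-∈ f (there x∈)  eq = ≤-trans (count-∈ f x∈ eq) (m≤n+m _ _)

  extract : {x : A} {xs : List A} → x ∈ xs → ∃ λ ys → xs ↭ x ∷ ys
  extract {xs = x ∷ xs} (here refl) = xs , ↭-refl
  extract {xs = x ∷ xs} (there x∈)  = let ys , p = extract x∈ in x ∷ ys , ↭-trans (prep x p) (swap x _ ↭-refl)

  count-mono : {f g : A → Bool} → ∀ xs → (∀ {x} → x ∈ xs → f x ≡ true → g x ≡ true) → count f xs ≤ count g xs
  count-mono []       h = z≤n
  count-mono {f} {g} (x ∷ xs) h with f x in eq
  ... | false = ≤-trans (count-mono xs (h ∘ there)) (m≤n+m _ _)
  ... | true rewrite h (here refl) eq = s≤s (count-mono xs (h ∘ there))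

  count-strict : {f g : A → Bool} → ∀ xs → (∀ {x} → f x ≡ true → g x ≡ true) →
    ∀ {x} → x ∈ xs → f x ≡ false → g x ≡ true → suc (count f xs) ≤ count g xs
  count-strict (x ∷ xs) h (here refl) fx gx rewrite fx | gx = s≤s (count-mono xs (λ _ → h))
  count-strict {f} {g} (y ∷ xs) h (there x∈) fx gx with f y in eq
  ... | true rewrite h eq = s≤s (count-strict xs h x∈ fx gx)
  ... | false = ≤-trans (count-strict xs h x∈ fx gx) (m≤n+m _ _)

  -- The last clause is the equality case: when `f` and `g` are disjoint and fill `s` numerically,
  -- they cover it. This is the source of every `cover` below.
  pigeonhole : (f g s : A → Bool) → ∀ es →
    (∀ {e} → e ∈ es → f e ≡ true → s e ≡ true) → (∀ {e} → e ∈ es → g e ≡ true → s e ≡ true) →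
    (∃ λ e → e ∈ es × f e ≡ true × g e ≡ true) ⊎
    (count f es + count g es ≤ count s es ×
      (count s es ≤ count f es + count g es → ∀ {e} → e ∈ es → s e ≡ true → f e ≡ true ⊎ g e ≡ true))
  pigeonhole f g s [] f⇒s g⇒s = inj₂ (z≤n , λ _ ())
  pigeonhole f g s (e ∷ es) f⇒s g⇒s with pigeonhole f g s es (f⇒s ∘ there) (g⇒s ∘ there)
  ... | inj₁ (e′ , e∈ , p) = inj₁ (e′ , there e∈ , p)
  ... | inj₂ (le , cov) with f e in fe | g e in ge
  ...   | true  | true  = inj₁ (e , here refl , fe , ge)
  ...   | true  | false rewrite f⇒s (here refl) fe = inj₂ (s≤s le , λ { (s≤s q) → λ { (here refl) _ → inj₁ fe ; (there e∈) → cov q e∈ } })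
  ...   | false | true  rewrite g⇒s (here refl) ge | +-suc (count f es) (count g es) =
    inj₂ (s≤s le , λ { (s≤s q) → λ { (here refl) _ → inj₂ ge ; (there e∈) → cov q e∈ } })
  ...   | false | false with s e in se
  ...     | false = inj₂ (le , λ { q (here refl) se′ → ⊥-elim (contra (Eq.trans (sym se) se′)) ; q (there e∈) → cov q e∈ })
    where contra : false ≡ true → ⊥
          contra ()
  ...     | true  = inj₂ (≤-trans le (n≤1+n _) , λ q → ⊥-elim (1+n≰n (≤-trans q le)))

  separate : (f g : A → Bool) → ∀ es → suc (count g es) ≤ count f es → ∃ λ e → e ∈ es × f e ≡ true × g e ≡ false
  separate f g (e ∷ es) lt with f e in fe | g e in ge
  ... | true  | false = e , here refl , fe , ge
  ... | true  | true  = let e′ , i , p = separate f g es (s≤s⁻¹ lt) in e′ , there i , p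
  ... | false | false = let e′ , i , p = separate f g es lt in e′ , there i , p
  ... | false | true  = let e′ , i , p = separate f g es (≤-trans (n≤1+n _) lt) in e′ , there i , p

  count-∨ : (f g : A → Bool) → ∀ xs → (∀ {x} → x ∈ xs → f x ≡ true → g x ≡ false) →
    count (λ x → f x ∨ g x) xs ≡ count f xs + count g xs
  count-∨ f g []       ex = refl
  count-∨ f g (x ∷ xs) ex with f x in fx
  ... | true rewrite ex (here refl) fx = cong suc (count-∨ f g xs (ex ∘ there))
  ... | false = Eq.trans (cong (# (g x) +_) (count-∨ f g xs (ex ∘ there)))
    (solve 3 (λ a b c → a :+ (b :+ c) := b :+ (a :+ c)) refl (# (g x)) (count f xs) (count g xs))
    where open +-*-Solver

  count-not : (f : A → Bool) → ∀ xs → count f xs + count (not ∘ f) xs ≡ count (λ _ → true) xs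
  count-not f []       = refl
  count-not f (x ∷ xs) with f x
  ... | true  = cong suc (count-not f xs)
  ... | false = Eq.trans (+-suc _ _) (cong suc (count-not f xs))

  sumBy-mono : {f g : A → ℕ} → ∀ xs → (∀ {x} → x ∈ xs → f x ≤ g x) → sumBy f xs ≤ sumBy g xs
  sumBy-mono []       h = z≤n
  sumBy-mono (x ∷ xs) h = +-mono-≤ (h (here refl)) (sumBy-mono xs (h ∘ there))

  sumBy-+ : (f g : A → ℕ) → ∀ xs → sumBy (λ x → f x + g x) xs ≡ sumBy f xs + sumBy g xs
  sumBy-+ f g []       = refl
  sumBy-+ f g (x ∷ xs) = Eq.trans (cong (f x + g x +_) (sumBy-+ f g xs))
    (solve 4 (λ a b c d → (a :+ b) :+ (c :+ d) := (a :+ c) :+ (b :+ d)) refl (f x) (g x) (sumBy f xs) (sumBy g xs))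
    where open +-*-Solver

  sumBy-# : (f : A → Bool) → ∀ xs → sumBy (# ∘ f) xs ≡ count f xs
  sumBy-# f []       = refl
  sumBy-# f (x ∷ xs) = cong (# (f x) +_) (sumBy-# f xs)

  sumBy-const : ∀ k (f : A → Bool) xs → sumBy (λ x → # (f x) * k) xs ≡ count f xs * k
  sumBy-const k f []       = refl
  sumBy-const k f (x ∷ xs) = Eq.trans (cong (# (f x) * k +_) (sumBy-const k f xs)) (sym (*-distribʳ-+ k (# (f x)) _))

sumBy-swap : ∀ {A B : Set} (R : A → B → Bool) as bs →
  sumBy (λ a → count (R a) bs) as ≡ sumBy (λ b → count (λ a → R a b) as) bs
sumBy-swap R []       bs = sym (zeros bs)
  where zeros : ∀ bs → sumBy (λ b → 0) bs ≡ 0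
        zeros []       = refl
        zeros (_ ∷ bs) = zeros bs
sumBy-swap R (a ∷ as) bs = begin
    count (R a) bs + sumBy (λ a → count (R a) bs) as               ≡⟨ cong₂ _+_ (sym (sumBy-# (R a) bs)) (sumBy-swap R as bs) ⟩
    sumBy (# ∘ R a) bs + sumBy (λ b → count (λ a → R a b) as) bs   ≡⟨ sym (sumBy-+ (# ∘ R a) _ bs) ⟩
    sumBy (λ b → # (R a b) + count (λ a → R a b) as) bs            ∎
  where open ≡-Reasoning

module _ {A : Set} {W : Set} where

  -- Constructive form of "assume that no choice wins": either some element yields `W`, or the bound
  -- that failure gives is available at all elements and can be summed.
  sequence : {P : A → Set} (xs : List A) → (∀ {x} → x ∈ xs → W ⊎ P x) → W ⊎ (∀ {x} → x ∈ xs → P x)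
  sequence []       h = inj₂ λ ()
  sequence (x ∷ xs) h with h (here refl) | sequence xs (h ∘ there)
  ... | inj₁ w | _      = inj₁ w
  ... | inj₂ _ | inj₁ w = inj₁ w
  ... | inj₂ p | inj₂ q = inj₂ λ { (here refl) → p ; (there x∈) → q x∈ }

true≢false : {b : Bool} → b ≡ true → b ≡ false → ⊥
true≢false refl ()

eqᵇ-refl : ∀ b → eqᵇ b b ≡ true
eqᵇ-refl true  = refl
eqᵇ-refl false = refl

eqᵇ-not : ∀ b → eqᵇ b (not b) ≡ false
eqᵇ-not true  = refl
eqᵇ-not false = refl

eqᵇ⇒≡ : ∀ {a b} → eqᵇ a b ≡ true → a ≡ b
eqᵇ⇒≡ {true}  {true}  _ = refl
eqᵇ⇒≡ {false} {false} _ = refl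

eqᵇ-≡ : ∀ {a b} → a ≡ b → eqᵇ a b ≡ true
eqᵇ-≡ {a} refl = eqᵇ-refl a

eqᵇ-≡not : ∀ {a b} → b ≡ not a → eqᵇ a b ≡ false
eqᵇ-≡not {a} refl = eqᵇ-not a

not-flip : ∀ {a b} → a ≡ not b → b ≡ not a
not-flip {b = b} refl = sym (not-involutive b)

-- A walk is stored together with the bag of its vertices ι v and colours κ c,
-- so that one permutation states which vertices and colours are left over.
pattern ι v = inj₁ v
pattern κ c = inj₂ c

onV : ∀ {V C : Set} → (V → Bool) → V ⊎ C → Bool
onV f (ι v) = f v
onV f (κ _) = false

onC : ∀ {V C : Set} → (C → Bool) → V ⊎ C → Bool
onC f (ι _) = false
onC f (κ c) = f c

-- Coloured walks: joining, reversing, splitting at an edge.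

module Walks
  {V C : Set} (side : V → Bool) (adj : C → V → V → Bool)
  (adj-sym : ∀ c u v → adj c u v ≡ adj c v u)
  (adj-side : ∀ c u v → adj c u v ≡ true → side v ≡ not (side u))
  where

  Item : Set
  Item = V ⊎ C

  Edge : Set
  Edge = V × C × V

  tail head : Edge → V
  tail (p , _ , _) = p
  head (_ , _ , q) = q

  colour : Edge → C
  colour (_ , k , _) = k

  -- Nothing here forbids repetitions. That a walk is a rainbow path comes only from its bag fitting
  -- into the stock of all vertices and colours.
  data Walk : V → V → List Item → Set where
    end  : ∀ v → Walk v v [ ι v ]
    step : ∀ u k {v w xs} → adj k u v ≡ true → Walk v w xs → Walk u w (ι u ∷ κ k ∷ xs)

  Path : V → V → List Item → Set
  Path u v xs = ∃ λ ys → Walk u v ys × ys ↭ xs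

  path : ∀ {u v xs} → Walk u v xs → Path u v xs
  path W = _ , W , ↭-refl

  repath : ∀ {u v xs ys} → Path u v xs → xs ↭ ys → Path u v ys
  repath (_ , W , p) q = _ , W , ↭-trans p q

  edges : ∀ {u v xs} → Walk u v xs → List Edge
  edges (end v)                = []
  edges (step u k {v} a W)     = (u , k , v) ∷ edges W

  adj′ : ∀ {c u v} → adj c u v ≡ true → adj c v u ≡ true
  adj′ {c} {u} {v} a = Eq.trans (adj-sym c v u) a

  same-side : ∀ {c u v} → side u ≡ side v → adj c u v ≡ false
  same-side {c} {u} {v} e with adj c u v in a
  ... | false = refl
  ... | true  = ⊥-elim (absurd (side v) (Eq.trans (sym (adj-side c u v a)) (sym e)) e)
    where absurd : ∀ b → not (side u) ≡ side u → side u ≡ b → ⊥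
          absurd b p _ with side u
          absurd b () _ | true
          absurd b () _ | false

  no-loop : ∀ {c u} → adj c u u ≡ false
  no-loop = same-side refl

  joinW : ∀ {u p q v xs ys} k → Walk u p xs → adj k p q ≡ true → Walk q v ys → Walk u v (xs ++ κ k ∷ ys)
  joinW k (end v)       a W′ = step v k a W′
  joinW k (step u c b W) a W′ = step u c b (joinW k W a W′)

  edges-joinW : ∀ {u p q v xs ys} k (W : Walk u p xs) (a : adj k p q ≡ true) (W′ : Walk q v ys) →
    edges (joinW k W a W′) ≡ edges W ++ (p , k , q) ∷ edges W′
  edges-joinW k (end v)        a W′ = refl
  edges-joinW k (step u c b W) a W′ = cong (_ ∷_) (edges-joinW k W a W′)

  join : ∀ {u p q v xs ys} k → Path u p xs → adj k p q ≡ true → Path q v ys → Path u v (κ k ∷ xs ++ ys)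
  join k (as , W , p) a (bs , W′ , q) = _ , joinW k W a W′ ,
    ↭-trans (shift (κ k) as bs) (prep (κ k) (++⁺ p q))

  rev : ∀ {u v xs} → Path u v xs → Path v u xs
  rev (ys , W , p) = repath (revW W) p
    where
    revW : ∀ {u v xs} → Walk u v xs → Path v u xs
    revW (end v) = path (end v)
    revW (step u k {xs = xs} a W) = repath (join k (revW W) (adj′ a) (path (end u)))
      (solve 3 (λ k xs u → k ⊕ (xs ⊕ u) ⊜ u ⊕ (k ⊕ xs)) ↭-refl [ κ k ] xs [ ι u ])
      where open CMSolver (++-commutativeMonoid {A = Item})

  record Split {u v xs} (W : Walk u v xs) (e : Edge) : Set where
    constructor mkSplit
    field
      {xs₁ xs₂} : List Item
      W₁        : Walk u (tail e) xs₁
      link      : adj (colour e) (tail e) (head e) ≡ true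
      W₂        : Walk (head e) v xs₂
      items     : xs ≡ xs₁ ++ κ (colour e) ∷ xs₂
      edges-≡   : edges W ≡ edges W₁ ++ e ∷ edges W₂

  split : ∀ {u v xs e} (W : Walk u v xs) → e ∈ edges W → Split W e
  split (step u k a W) (here refl) = mkSplit (end u) a W refl refl
  split (step u k a W) (there e∈)  = let mkSplit W₁ l W₂ i j = split W e∈ in
    mkSplit (step u k a W₁) l W₂ (cong (λ z → ι u ∷ κ k ∷ z) i) (cong (_ ∷_) j)

  edge-adj : ∀ {u v xs e} (W : Walk u v xs) → e ∈ edges W → adj (colour e) (tail e) (head e) ≡ true
  edge-adj W e∈ = Split.link (split W e∈)

  -- Every vertex but the first is the head of exactly one edge. This and the version for tails turn
  -- degrees into counts of edges, where `pigeonhole` applies.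
  count-heads : ∀ (f : V → Bool) {u v xs} (W : Walk u v xs) → count (onV f) xs ≡ # (f u) + count (f ∘ head) (edges W)
  count-heads f (end v)        = refl
  count-heads f (step u k a W) = cong (# (f u) +_) (count-heads f W)

  count-tails : ∀ (f : V → Bool) {u v xs} (W : Walk u v xs) → count (onV f) xs ≡ count (f ∘ tail) (edges W) + # (f v)
  count-tails f (end v)        = +-identityʳ _
  count-tails f (step u k a W) = Eq.trans (cong (# (f u) +_) (count-tails f W)) (sym (+-assoc (# (f u)) _ _))

  count-heads′ : ∀ (f : V → Bool) {u v xs} (W : Walk u v xs) → f u ≡ false → count (onV f) xs ≡ count (f ∘ head) (edges W)
  count-heads′ f W eq = Eq.trans (count-heads f W) (cong (λ b → # b + count (f ∘ head) (edges W)) eq)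

  count-tails′ : ∀ (f : V → Bool) {u v xs} (W : Walk u v xs) → f v ≡ false → count (onV f) xs ≡ count (f ∘ tail) (edges W)
  count-tails′ f W eq = Eq.trans (count-tails f W)
    (Eq.trans (cong (λ b → count (f ∘ tail) (edges W) + # b) eq) (+-identityʳ _))

  count-colours : ∀ (f : C → Bool) {u v xs} (W : Walk u v xs) → count (onC f) xs ≡ count (f ∘ colour) (edges W)
  count-colours f (end v)        = refl
  count-colours f (step u k a W) = cong (# (f k) +_) (count-colours f W)

  head-edge : ∀ {u v xs z} (W : Walk u v xs) → ι z ∈ xs → z ≡ u ⊎ ∃ λ e → e ∈ edges W × head e ≡ z
  head-edge (end v)        (here refl)         = inj₁ refl
  head-edge (step u k a W) (here refl)         = inj₁ refl
  head-edge (step u k {v} a W) (there (there z∈)) with head-edge W z∈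
  ... | inj₁ refl           = inj₂ (_ , here refl , refl)
  ... | inj₂ (e , e∈ , eq)  = inj₂ (e , there e∈ , eq)

  start∈ : ∀ {u v xs} → Walk u v xs → ι u ∈ xs
  start∈ (end v)        = here refl
  start∈ (step u k a W) = here refl

-- Paths and cycles that miss two opposite vertices.

module Setting
  {V C : Set} (side : V → Bool) (adj : C → V → V → Bool)
  (adj-sym : ∀ c u v → adj c u v ≡ adj c v u)
  (adj-side : ∀ c u v → adj c u v ≡ true → side v ≡ not (side u))
  (Stock : List (V ⊎ C)) (n h : ℕ) (n≤2h : n ≤ h + h)
  (side-size : ∀ s → count (onV (eqᵇ s ∘ side)) Stock ≡ n)
  (colours-size : suc (count (onC (λ _ → true)) Stock) ≡ n + n)
  (degree : ∀ c v → h ≤ count (onV (adj c v)) Stock)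
  (distinct : ∀ {z rest} → Stock ↭ ι z ∷ ι z ∷ rest → ⊥)
  (1≤n : 1 ≤ n) (every-colour : ∀ c → κ c ∈ Stock)
  where

  open Walks side adj adj-sym adj-side

  module Bag = CMSolver (++-commutativeMonoid {A = Item})

  Win : Set
  Win = ∃ λ u → ∃ λ v → Path u v Stock

  win : ∀ {u v xs} → Path u v xs → xs ↭ Stock → Win
  win P p = _ , _ , repath P p

  record AvoidingPath (x y w t : V) (α β : C) : Set where
    constructor mkPath
    field
      {items} : List Item
      walk    : Walk w t items
      perm    : ι x ∷ ι y ∷ κ α ∷ κ β ∷ items ↭ Stock
      side-y  : side y ≡ not (side x)
      side-w  : side w ≡ side y
      side-t  : side t ≡ side x

  avoidingPath : ∀ {x y w t α β xs} → Path w t xs → ι x ∷ ι y ∷ κ α ∷ κ β ∷ xs ↭ Stock →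
    side y ≡ not (side x) → side w ≡ side y → side t ≡ side x → AvoidingPath x y w t α β
  avoidingPath (_ , W , p) q = mkPath W (↭-trans (prep _ (prep _ (prep _ (prep _ p)))) q)

  reversed : ∀ {x y w t α β} → AvoidingPath x y w t α β → AvoidingPath y x t w α β
  reversed {x} {y} {w} {t} {α} {β} (mkPath {xs} W p sy sw st) = avoidingPath (rev (path W))
    (↭-trans (swap _ _ ↭-refl) p) (not-flip sy) st sw

  recoloured : ∀ {x y w t α β} → AvoidingPath x y w t α β → AvoidingPath x y w t β α
  recoloured (mkPath W p sy sw st) = mkPath W (↭-trans (prep _ (prep _ (swap _ _ ↭-refl))) p) sy sw st

  -- A rainbow cycle through all other vertices, cut open at its edge of colour `closing`; `c` is
  -- the one colour it does not use.
  record AvoidingCycle (x y : V) (c : C) : Set where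
    constructor mkCycle
    field
      {start stop} : V
      {closing}    : C
      {items}      : List Item
      walk         : Walk start stop items
      close        : adj closing stop start ≡ true
      perm         : ι x ∷ ι y ∷ κ c ∷ κ closing ∷ items ↭ Stock
      side-y       : side y ≡ not (side x)
      side-start   : side start ≡ side y
      side-stop    : side stop ≡ side x

  avoidingCycle : ∀ {x y a b c d xs} → Path a b xs → adj d b a ≡ true → ι x ∷ ι y ∷ κ c ∷ κ d ∷ xs ↭ Stock →
    side y ≡ not (side x) → side a ≡ side y → side b ≡ side x → AvoidingCycle x y c
  avoidingCycle (_ , W , p) a q = mkCycle W a (↭-trans (prep _ (prep _ (prep _ (prep _ p)))) q)

  -- The equality case of the crossing count: with both of `w x` and `t y` present the path extends
  -- to a win, with neither the degrees are too large, and with exactly one the two neighbourhoods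
  -- fill the walk completely.
  record HalfTied (x y w t : V) (α β : C) (es : List Edge) : Set where
    constructor mkHalfTied
    field
      xor   : adj α w x ≡ not (adj β t y)
      cover : ∀ {e} → e ∈ es → side (head e) ≡ side x → adj α w (head e) ≡ true ⊎ adj β t (tail e) ≡ true

  onSide : Bool → Edge → Bool
  onSide s e = eqᵇ s (side (head e))

  -- The crossing argument of Ore and Pósa, with the exact bound. The terms with `#` correct for the
  -- ends: `u` is no head and `v` is no tail of an edge.
  cross : ∀ {u v xs} (W : Walk u v xs) (φ ψ : V → Bool) (s : Bool) →
    (∀ q → φ q ≡ true → side q ≡ s) → (∀ p → ψ p ≡ true → side p ≡ not s) →
    (∃ λ e → e ∈ edges W × φ (head e) ≡ true × ψ (tail e) ≡ true) ⊎
    (count (onV φ) xs + count (onV ψ) xs + # (eqᵇ s (side u)) ≤ count (onV (eqᵇ s ∘ side)) xs + (# (φ u) + # (ψ v)) ×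
      (count (onV (eqᵇ s ∘ side)) xs + (# (φ u) + # (ψ v)) ≤ count (onV φ) xs + count (onV ψ) xs + # (eqᵇ s (side u)) →
        ∀ {e} → e ∈ edges W → side (head e) ≡ s → φ (head e) ≡ true ⊎ ψ (tail e) ≡ true))
  cross {u} {v} {xs} W φ ψ s φ-s ψ-s
    with pigeonhole (φ ∘ head) (ψ ∘ tail) (onSide s) (edges W)
           (λ _ a → eqᵇ-≡ (sym (φ-s _ a)))
           (λ e∈ a → eqᵇ-≡ (sym (Eq.trans (adj-side _ _ _ (edge-adj W e∈)) (Eq.trans (cong not (ψ-s _ a)) (not-involutive s)))))
  ... | inj₁ found = inj₁ found
  ... | inj₂ (le , cov) rewrite count-heads φ W | count-tails ψ W | count-heads (eqᵇ s ∘ side) W =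
    inj₂ ( subst₂ _≤_ (sym lhs) (sym rhs) (+-monoʳ-≤ (a + b + c) le)
         , λ ge e∈ se → cov (+-cancelˡ-≤ (a + b + c) _ _ (subst₂ _≤_ rhs lhs ge)) e∈ (eqᵇ-≡ (sym se)) )
    where
    open +-*-Solver
    a = # (φ u)
    b = # (ψ v)
    c = # (eqᵇ s (side u))
    F = count (φ ∘ head) (edges W)
    G = count (ψ ∘ tail) (edges W)
    R = count (onSide s) (edges W)
    lhs : a + F + (G + b) + c ≡ a + b + c + (F + G)
    lhs = solve 5 (λ a b c F G → a :+ F :+ (G :+ b) :+ c := a :+ b :+ c :+ (F :+ G)) refl a b c F G
    rhs : c + R + (a + b) ≡ a + b + c + R
    rhs = solve 4 (λ a b c R → c :+ R :+ (a :+ b) := a :+ b :+ c :+ R) refl a b c R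

  win-around : ∀ {x y w t α β} → AvoidingPath x y w t α β → adj α w x ≡ true → adj β t y ≡ true → Win
  win-around {x} {y} {w} {t} {α} {β} (mkPath {xs} W p sy sw st) a b =
    win (join α (path (end x)) (adj′ a) (join β (path W) b (path (end y))))
      (↭-trans (Bag.solve 5 (λ x y a b xs → a Bag.⊕ (x Bag.⊕ (b Bag.⊕ (xs Bag.⊕ y))) Bag.⊜ x Bag.⊕ (y Bag.⊕ (a Bag.⊕ (b Bag.⊕ xs)))) ↭-refl
        [ ι x ] [ ι y ] [ κ α ] [ κ β ] xs) p)

  -- The α-neighbours of w, shifted back along the walk (and x shifted to y), and the β-neighbours of t
  -- number at least n together; all of them lie on the side of y, which has size n.
  close-or-tie : ∀ {x y w t α β} (q : AvoidingPath x y w t α β) → Win ⊎ ∃ (AvoidingCycle x y) ⊎ HalfTied x y w t α β (edges (AvoidingPath.walk q))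
  close-or-tie {x} {y} {w} {t} {α} {β} q@(mkPath {xs} W perm sy sw st)
    with cross W (adj α w) (adj β t) (side x)
           (λ z a → Eq.trans (adj-side α w z a) (Eq.trans (cong not (Eq.trans sw sy)) (not-involutive _)))
           (λ z a → Eq.trans (adj-side β t z a) (cong not st))
  ... | inj₁ ((p , k , z) , e∈ , wz , tp) with split W e∈
  ...   | mkSplit {as} {bs} W₁ l W₂ refl _ = inj₂ (inj₁ (k , avoidingCycle (join α (rev (path W₁)) wz (path W₂)) tp
            (↭-trans (Bag.solve 7 (λ x y a b k as bs → x Bag.⊕ (y Bag.⊕ (k Bag.⊕ (b Bag.⊕ (a Bag.⊕ (as Bag.⊕ bs))))) Bag.⊜ x Bag.⊕ (y Bag.⊕ (a Bag.⊕ (b Bag.⊕ (as Bag.⊕ (k Bag.⊕ bs))))))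
              ↭-refl [ ι x ] [ ι y ] [ κ α ] [ κ β ] [ κ k ] as bs) perm)
            sy (Eq.trans (adj-side β t p tp) (Eq.trans (cong not st) (sym sy))) st))
  close-or-tie {x} {y} {w} {t} {α} {β} q@(mkPath {xs} W perm sy sw st)
      | inj₂ (le , cov) = decide (adj α w x) refl (adj β t y) refl
    where
    F = count (onV (adj α w)) xs
    G = count (onV (adj β t)) xs
    R = count (onV (eqᵇ (side x) ∘ side)) xs
    degF : h ≤ # (adj α w x) + F
    degF = ≤-trans (degree α w) (≤-reflexive (Eq.trans (sym (count-↭ (onV (adj α w)) perm))
             (cong (λ b → # (adj α w x) + (# b + F)) (same-side {α} {w} {y} sw))))
    degG : h ≤ # (adj β t y) + G
    degG = ≤-trans (degree β t) (≤-reflexive (Eq.trans (sym (count-↭ (onV (adj β t)) perm))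
             (cong (λ b → # b + (# (adj β t y) + G)) (same-side {β} {t} {x} st))))
    size : n ≡ suc R
    size = Eq.trans (sym (side-size (side x))) (Eq.trans (sym (count-↭ (onV (eqᵇ (side x) ∘ side)) perm))
             (cong₂ (λ a b → # a + (# b + R)) (eqᵇ-refl (side x)) (eqᵇ-≡not sy)))
    le′ : F + G ≤ R
    le′ = subst₂ _≤_ (Eq.trans (cong (λ b → F + G + # b) (eqᵇ-≡not (Eq.trans sw sy))) (+-identityʳ _))
                     (Eq.trans (cong₂ (λ a b → R + (# a + # b)) (no-loop {α} {w}) (no-loop {β} {t})) (+-identityʳ _)) le
    cov′ : R ≤ F + G → ∀ {e} → e ∈ edges W → side (head e) ≡ side x → adj α w (head e) ≡ true ⊎ adj β t (tail e) ≡ true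
    cov′ ge = cov (subst₂ _≤_ (sym (Eq.trans (cong₂ (λ a b → R + (# a + # b)) (no-loop {α} {w}) (no-loop {β} {t})) (+-identityʳ _)))
                     (sym (Eq.trans (cong (λ b → F + G + # b) (eqᵇ-≡not (Eq.trans sw sy))) (+-identityʳ _))) ge)
    total : ∀ a b → h ≤ a + F → h ≤ b + G → suc R ≤ a + b + (F + G)
    total a b p q = ≤-trans (≤-reflexive (sym size)) (≤-trans n≤2h (≤-trans (+-mono-≤ p q)
      (≤-reflexive (solve 4 (λ a b F G → a :+ F :+ (b :+ G) := a :+ b :+ (F :+ G)) refl a b F G))))
      where open +-*-Solver
    decide : ∀ a → adj α w x ≡ a → ∀ b → adj β t y ≡ b → Win ⊎ ∃ (AvoidingCycle x y) ⊎ HalfTied x y w t α β (edges W)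
    decide true  p true  r = inj₁ (win-around q p r)
    decide false p false r = ⊥-elim (1+n≰n (≤-trans (total 0 0 (subst (λ b → h ≤ # b + F) p degF) (subst (λ b → h ≤ # b + G) r degG)) le′))
    decide true  p false r = inj₂ (inj₂ (mkHalfTied (Eq.trans p (cong not (sym r)))
      (cov′ (s≤s⁻¹ (total 1 0 (subst (λ b → h ≤ # b + F) p degF) (subst (λ b → h ≤ # b + G) r degG))))))
    decide false p true  r = inj₂ (inj₂ (mkHalfTied (Eq.trans p (cong not (sym r)))
      (cov′ (s≤s⁻¹ (total 0 1 (subst (λ b → h ≤ # b + F) p degF) (subst (λ b → h ≤ # b + G) r degG))))))

  close-ends : ∀ {x y w t α β} → AvoidingPath x y w t α β → adj α t w ≡ true → AvoidingCycle x y β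
  close-ends (mkPath W perm sy sw st) a = mkCycle W a (↭-trans (prep _ (prep _ (swap _ _ ↭-refl))) perm) sy sw st

  Outcome : (x y : V) → Set → Set
  Outcome x y A = Win ⊎ ∃ (AvoidingCycle x y) ⊎ A

  _>>=_ : ∀ {x y A A′} → Outcome x y A → (A → Outcome x y A′) → Outcome x y A′
  inj₁ v        >>= k = inj₁ v
  inj₂ (inj₁ b) >>= k = inj₂ (inj₁ b)
  inj₂ (inj₂ a) >>= k = k a

  record Tied (x y w t : V) (α β : C) (es : List Edge) : Set where
    constructor mkTied
    field
      x-α   : adj α w x ≡ true
      x-β   : adj β w x ≡ true
      y-α   : adj α t y ≡ false
      y-β   : adj β t y ≡ false
      cover : ∀ {e} → e ∈ es → side (head e) ≡ side x → adj α w (head e) ≡ true ⊎ adj β t (tail e) ≡ true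

  record Tied′ (x y w t : V) (α β : C) : Set where
    constructor mkTied′
    field
      x-α   : adj α w x ≡ false
      x-β   : adj β w x ≡ false
      y-α   : adj α t y ≡ true
      y-β   : adj β t y ≡ true

  -- If w and t were tied to x and y in the same single colour, the first edge could be recoloured
  -- by either missing colour, and the resulting ties would contradict each other.
  classify : ∀ {x y w t α β} (q : AvoidingPath x y w t α β) →
    Outcome x y (Tied x y w t α β (edges (AvoidingPath.walk q)) ⊎ Tied′ x y w t α β)
  classify {x} (mkPath (end v) perm sy sw st) = ⊥-elim (true≢false (eqᵇ-refl (side x))
    (eqᵇ-≡not (Eq.trans (sym st) (Eq.trans sw sy))))
  classify {x} {y} {w} {t} {α} {β} q@(mkPath (step w k {u} a W) perm sy sw st) =
    close-or-tie q >>= λ H → close-or-tie (recoloured q) >>= λ H′ → decide H H′ (adj α w x) refl (adj β w x) refl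
    where
    su : side u ≡ side x
    su = Eq.trans (adj-side k w u a) (Eq.trans (cong not (Eq.trans sw sy)) (not-involutive _))
    R = Tied x y w t α β ((w , k , u) ∷ edges W) ⊎ Tied′ x y w t α β
    flip : ∀ {b c d : Bool} → b ≡ not c → b ≡ d → c ≡ not d
    flip p refl = not-flip p
    first : ∀ {γ δ} → AvoidingPath x y w t γ δ → adj γ w u ≡ true ⊎ adj δ t w ≡ true → Outcome x y (adj γ w u ≡ true)
    first q (inj₁ p) = inj₂ (inj₂ p)
    first q (inj₂ p) = inj₂ (inj₁ (_ , close-ends (recoloured q) p))
    recolour-first : ∀ {γ δ} → ι x ∷ ι y ∷ κ γ ∷ κ δ ∷ ι w ∷ κ k ∷ _ ↭ Stock → adj γ w u ≡ true → AvoidingPath x y w t k δ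
    recolour-first {γ} {δ} p b = mkPath (step w γ b W) (↭-trans (Bag.solve 7 (λ x y k d w c xs →
      x Bag.⊕ (y Bag.⊕ (k Bag.⊕ (d Bag.⊕ (w Bag.⊕ (c Bag.⊕ xs))))) Bag.⊜ x Bag.⊕ (y Bag.⊕ (c Bag.⊕ (d Bag.⊕ (w Bag.⊕ (k Bag.⊕ xs))))))
      ↭-refl [ ι x ] [ ι y ] [ κ k ] [ κ δ ] [ ι w ] [ κ γ ] _) p) sy sw st
    three : ∀ {γ δ} → AvoidingPath x y w t γ δ → ι x ∷ ι y ∷ κ γ ∷ κ δ ∷ ι w ∷ κ k ∷ _ ↭ Stock → ι x ∷ ι y ∷ κ δ ∷ κ γ ∷ ι w ∷ κ k ∷ _ ↭ Stock →
      (adj γ w u ≡ true ⊎ adj δ t w ≡ true) → (adj δ w u ≡ true ⊎ adj γ t w ≡ true) →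
      adj γ w x ≡ true → adj δ w x ≡ false → adj γ t y ≡ true → adj δ t y ≡ false → Outcome x y R
    three q p p′ cγ cδ xγ xδ yγ yδ = first q cγ >>= λ bγ → first (recoloured q) cδ >>= λ bδ →
      close-or-tie (recolour-first p bγ) >>= λ H₁ → close-or-tie (recolour-first p′ bδ) >>= λ H₂ →
      ⊥-elim (clash (HalfTied.xor H₁) (HalfTied.xor H₂) yδ yγ)
      where
      clash : ∀ {b c d} → b ≡ not c → b ≡ not d → c ≡ false → d ≡ true → ⊥
      clash refl () refl refl
    decide : HalfTied x y w t α β _ → HalfTied x y w t β α _ → ∀ b → adj α w x ≡ b → ∀ c → adj β w x ≡ c → Outcome x y R
    decide H H′ true  p true  r = inj₂ (inj₂ (inj₁ (mkTied p r (flip (HalfTied.xor H′) r) (flip (HalfTied.xor H) p) (HalfTied.cover H))))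
    decide H H′ false p false r = inj₂ (inj₂ (inj₂ (mkTied′ p r (flip (HalfTied.xor H′) r) (flip (HalfTied.xor H) p))))
    decide H H′ true  p false r = three q perm (AvoidingPath.perm (recoloured q)) (HalfTied.cover H (here refl) su) (HalfTied.cover H′ (here refl) su) p r
      (flip (HalfTied.xor H′) r) (flip (HalfTied.xor H) p)
    decide H H′ false p true  r = three (recoloured q) (AvoidingPath.perm (recoloured q)) perm (HalfTied.cover H′ (here refl) su) (HalfTied.cover H (here refl) su) r p
      (flip (HalfTied.xor H) p) (flip (HalfTied.xor H′) r)

  -- Winning from a cycle whose missing colour joins the two missing vertices.

  rotate-cycle : ∀ {x y c} (b : AvoidingCycle x y c) {e} → e ∈ edges (AvoidingCycle.walk b) → side (head e) ≡ side y →
    ∃ λ as → ∃ λ bs → Σ (Walk (head e) (AvoidingCycle.stop b) bs) λ W₂ → Σ (Walk (AvoidingCycle.start b) (tail e) as) λ W₁ →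
      edges (AvoidingCycle.walk b) ≡ edges W₁ ++ e ∷ edges W₂ × AvoidingCycle.items b ≡ as ++ κ (colour e) ∷ bs
      × Σ (AvoidingCycle x y c) λ b′ → (AvoidingCycle.start b′ ≡ head e × AvoidingCycle.stop b′ ≡ tail e × AvoidingCycle.closing b′ ≡ colour e)
      × edges (AvoidingCycle.walk b′) ≡ edges W₂ ++ (AvoidingCycle.stop b , AvoidingCycle.closing b , AvoidingCycle.start b) ∷ edges W₁
      × AvoidingCycle.items b′ ≡ bs ++ κ (AvoidingCycle.closing b) ∷ as
  rotate-cycle {x} {y} {c} (mkCycle {w} {t} {d} W cl perm sy sw st) {e} e∈ se with split W e∈
  ... | mkSplit {as} {bs} W₁ l W₂ refl eq = as , bs , W₂ , W₁ , eq , refl ,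
    mkCycle (joinW d W₂ cl W₁) l (↭-trans (Bag.solve 7 (λ x y c k bs d as →
      x Bag.⊕ (y Bag.⊕ (c Bag.⊕ (k Bag.⊕ (bs Bag.⊕ (d Bag.⊕ as))))) Bag.⊜ x Bag.⊕ (y Bag.⊕ (c Bag.⊕ (d Bag.⊕ (as Bag.⊕ (k Bag.⊕ bs))))))
      ↭-refl [ ι x ] [ ι y ] [ κ c ] [ κ (colour e) ] bs [ κ d ] as) perm)
      sy se (Eq.trans (not-flip (adj-side _ _ _ l)) (Eq.trans (cong not (Eq.trans se sy)) (not-involutive _)))
    , (refl , refl , refl) , edges-joinW d W₂ cl W₁ , refl

  module _ {x y c} (b : AvoidingCycle x y c) where
    open AvoidingCycle b

    inner : ∀ (f : V → Bool) → f x ≡ false → f y ≡ false → count (onV f) items ≡ count (onV f) Stock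
    inner f fx fy = Eq.trans (cong₂ (λ a b → # a + (# b + count (onV f) items)) (sym fx) (sym fy)) (count-↭ (onV f) perm)

    inner-x : ∀ (f : V → Bool) → f y ≡ false → # (f x) + count (onV f) items ≡ count (onV f) Stock
    inner-x f fy = Eq.trans (cong (λ b → # (f x) + (# b + count (onV f) items)) (sym fy)) (count-↭ (onV f) perm)

    inner-y : ∀ (f : V → Bool) → f x ≡ false → # (f y) + count (onV f) items ≡ count (onV f) Stock
    inner-y f fx = Eq.trans (cong (λ b → # b + (# (f y) + count (onV f) items)) (sym fx)) (count-↭ (onV f) perm)

    inner-side-x : n ≡ suc (count (onV (eqᵇ (side x) ∘ side)) items)
    inner-side-x = Eq.trans (sym (side-size (side x))) (Eq.trans (sym (inner-x (eqᵇ (side x) ∘ side) (eqᵇ-≡not side-y)))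
      (cong (λ b → # b + count (onV (eqᵇ (side x) ∘ side)) items) (eqᵇ-refl (side x))))

    inner-side-y : n ≡ suc (count (onV (eqᵇ (side y) ∘ side)) items)
    inner-side-y = Eq.trans (sym (side-size (side y))) (Eq.trans (sym (inner-y (eqᵇ (side y) ∘ side) (eqᵇ-≡not (not-flip side-y))))
      (cong (λ b → # b + count (onV (eqᵇ (side y) ∘ side)) items) (eqᵇ-refl (side y))))

  module _ {x y c} (xy : adj c x y ≡ true) where

    towards : V → Edge → Bool
    towards v e = adj (colour e) (tail e) v

    -- Entering the stop v from p in the colour of an edge (p , q) and joining y to q in the closing colour wins.
    few : (b : AvoidingCycle x y c) →
      Win ⊎ suc (count (towards (AvoidingCycle.stop b)) (edges (AvoidingCycle.walk b)) + count (onV (adj (AvoidingCycle.closing b) y)) (AvoidingCycle.items b)) ≤ n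
    few b@(mkCycle {w} {t} {d} {xs} W cl perm sy sw st)
      with pigeonhole (towards t) (adj d y ∘ head) (onSide (side x)) (edges W)
        (λ {e} e∈ a → eqᵇ-≡ (Eq.trans (sym st) (Eq.trans (adj-side _ _ _ a) (sym (adj-side _ _ _ (edge-adj W e∈))))))
        (λ {e} e∈ a → eqᵇ-≡ (not-flip (Eq.trans sy (cong not refl)) ∙ sym (adj-side _ _ _ a)))
      where _∙_ = Eq.trans
    ... | inj₂ (le , _) = inj₂ (subst₂ _≤_ (cong (λ z → suc (count (towards t) (edges W) + z)) (sym heads-y))
          (Eq.trans (cong suc (sym heads-x)) (sym (inner-side-x b))) (s≤s le))
      where
      heads-y : count (onV (adj d y)) xs ≡ count (adj d y ∘ head) (edges W)
      heads-y = count-heads′ (adj d y) W (same-side {d} {y} {w} (sym sw))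
      heads-x : count (onV (eqᵇ (side x) ∘ side)) xs ≡ count (onSide (side x)) (edges W)
      heads-x = count-heads′ (eqᵇ (side x) ∘ side) W (eqᵇ-≡not (Eq.trans sw sy))
    ... | inj₁ ((p , k , q) , e∈ , pt , yq) with split W e∈
    ...   | mkSplit {as} {bs} W₁ l W₂ refl _ = inj₁ (win
            (join c (path (end x)) xy (join d (path (end y)) yq (join k (path W₂) (adj′ pt) (rev (path W₁)))))
            (↭-trans (Bag.solve 7 (λ x y c k d as bs →
               c Bag.⊕ (x Bag.⊕ (d Bag.⊕ (y Bag.⊕ (k Bag.⊕ (bs Bag.⊕ as))))) Bag.⊜ x Bag.⊕ (y Bag.⊕ (c Bag.⊕ (d Bag.⊕ (as Bag.⊕ (k Bag.⊕ bs))))))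
               ↭-refl [ ι x ] [ ι y ] [ κ c ] [ κ k ] [ κ d ] as bs) perm))

    module _ (b : AvoidingCycle x y c) where
      open AvoidingCycle b

      cycle : List Edge
      cycle = (stop , closing , start) ∷ edges walk

      -- The bound `few` for the cycle cut open at `e`, yet counted on the original walk. The counts
      -- agree because the two edges exchanged contribute nothing: the tail of `e` is no neighbour
      -- of itself, and `stop` lies on its side.
      few-at : ∀ {e} → e ∈ cycle → side (head e) ≡ side y →
        Win ⊎ suc (count (towards (tail e)) (edges walk) + count (onV (adj (colour e) y)) items) ≤ n
      few-at (here refl) _ = few b
      few-at {e} (there e∈) se with rotate-cycle b e∈ se
      ... | as , bs , W₂ , W₁ , eq , items-eq , b′@(mkCycle W′ cl perm′ _ _ _) , (refl , refl , refl) , eq′ , refl with few b′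
      ...   | inj₁ v  = inj₁ v
      ...   | inj₂ le = inj₂ (subst₂ (λ i j → suc (i + j) ≤ n) edges-count items-count le)
        where
        q = tail e
        sq : side q ≡ side x
        sq = Eq.trans (not-flip (adj-side _ _ _ cl)) (Eq.trans (cong not (Eq.trans se side-y)) (not-involutive _))
        edges-count : count (towards q) (edges W′) ≡ count (towards q) (edges walk)
        edges-count = Eq.trans (cong (count (towards q)) eq′) (Eq.trans
          (count-exchange (towards q) {a = e} (no-loop {colour e} {q}) (same-side {closing} {stop} {q} (Eq.trans side-stop (sym sq))) (edges W₁) (edges W₂))
          (cong (count (towards q)) (sym eq)))
        items-count : count (onV (adj (colour e) y)) (bs ++ κ closing ∷ as) ≡ count (onV (adj (colour e) y)) items
        items-count = Eq.trans (count-exchange (onV (adj (colour e) y)) {a = κ (colour e)} refl refl as bs)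
          (cong (count (onV (adj (colour e) y))) (sym items-eq))

      -- As xy has the colour missing on the cycle, every edge of the cycle can be dropped to free its colour.
      y-detour : ∀ {e} → e ∈ cycle → adj c x (head e) ≡ true → adj (colour e) x y ≡ true → Win
      y-detour (here refl) xq xy′ = win (join closing (path (end y)) (adj′ xy′) (join c (path (end x)) xq (path walk)))
        (↭-trans (Bag.solve 5 (λ x y c d xs → d Bag.⊕ (y Bag.⊕ (c Bag.⊕ (x Bag.⊕ xs))) Bag.⊜ x Bag.⊕ (y Bag.⊕ (c Bag.⊕ (d Bag.⊕ xs)))) ↭-refl
          [ ι x ] [ ι y ] [ κ c ] [ κ closing ] items) perm)
      y-detour {e} (there e∈) xq xy′ with split walk e∈
      ... | mkSplit {as} {bs} W₁ l W₂ items-eq _ = win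
        (join (colour e) (path (end y)) (adj′ xy′) (join c (path (end x)) xq (join closing (path W₂) close (path W₁))))
        (↭-trans (Bag.solve 7 (λ x y c k d as bs →
           k Bag.⊕ (y Bag.⊕ (c Bag.⊕ (x Bag.⊕ (d Bag.⊕ (bs Bag.⊕ as))))) Bag.⊜ x Bag.⊕ (y Bag.⊕ (c Bag.⊕ (d Bag.⊕ (as Bag.⊕ (k Bag.⊕ bs))))))
           ↭-refl [ ι x ] [ ι y ] [ κ c ] [ κ (colour e) ] [ κ closing ] as bs)
           (↭-trans (subst (λ z → ι x ∷ ι y ∷ κ c ∷ κ closing ∷ as ++ κ (colour e) ∷ bs ↭ ι x ∷ ι y ∷ κ c ∷ κ closing ∷ z) (sym items-eq) ↭-refl) perm))

      -- The roles of the colours are opposite to those in `y-detour`: here `c` is spent on `x y`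
      -- and the colour of the dropped edge on the link from `x` to the cycle.
      x-detour : ∀ {e} → e ∈ edges walk → side (tail e) ≡ side y → adj (colour e) x (tail e) ≡ true → Win
      x-detour {e} e∈ sp xp with split walk e∈
      ... | mkSplit {as} {bs} W₁ l W₂ items-eq _ = win
        (join c (path (end y)) (adj′ xy) (join (colour e) (path (end x)) xp (join closing (rev (path W₁)) (adj′ close) (rev (path W₂)))))
        (↭-trans (Bag.solve 7 (λ x y c k d as bs →
           c Bag.⊕ (y Bag.⊕ (k Bag.⊕ (x Bag.⊕ (d Bag.⊕ (as Bag.⊕ bs))))) Bag.⊜ x Bag.⊕ (y Bag.⊕ (c Bag.⊕ (d Bag.⊕ (as Bag.⊕ (k Bag.⊕ bs))))))
           ↭-refl [ ι x ] [ ι y ] [ κ c ] [ κ (colour e) ] [ κ closing ] as bs)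
           (↭-trans (subst (λ z → ι x ∷ ι y ∷ κ c ∷ κ closing ∷ as ++ κ (colour e) ∷ bs ↭ ι x ∷ ι y ∷ κ c ∷ κ closing ∷ z) (sym items-eq) ↭-refl) perm))

    -- Summed over the edges of the cycle leaving the side of x, the bound of few contradicts the degrees
    -- as soon as one of these edges has a colour not shared by xy.
    win-edge-and-cycle : 2 ≤ h → AvoidingCycle x y c → Win
    win-edge-and-cycle 2≤h b@(mkCycle {w} {t} {d} {xs} W cl perm sy sw st) =
      combine (sequence (cycle b) (λ {e} e∈ → cases e e∈)) (sequence (edges W) (λ {e} e∈ → free e e∈))
      where
      m = count (onV (eqᵇ (side x) ∘ side)) xs
      onY : Edge → Bool
      onY = onSide (side y)
      D : Edge → Item → Bool
      D e i = onY e ∧ onV (adj (colour e) y) i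
      -- The relation counted twice: for fixed `e` it is bounded by `few-at`, for fixed `e′` it is
      -- the degree of the tail of `e′` in the colour of `e′`.
      R : Edge → Edge → Bool
      R e e′ = onY e ∧ towards (tail e) e′
      cases : ∀ e → e ∈ cycle b → Win ⊎ count (R e) (edges W) + count (D e) xs ≤ # (onY e) * m
      cases e e∈ with onY e in oe
      ... | false = inj₂ (≤-reflexive (cong₂ _+_ (count-zero (λ _ → refl) (edges W)) (count-zero (λ _ → refl) xs)))
      ... | true with few-at b e∈ (sym (eqᵇ⇒≡ oe))
      ...   | inj₁ v  = inj₁ v
      ...   | inj₂ le = inj₂ (≤-trans (s≤s⁻¹ (subst (suc (count (towards (tail e)) (edges W) + count (onV (adj (colour e) y)) xs) ≤_) (inner-side-x b) le))
                          (≤-reflexive (sym (*-identityˡ m))))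
      free : ∀ e → e ∈ edges W → Win ⊎ # (onSide (side x) e) * h ≤ count (λ e′ → R e′ e) (cycle b)
      free e e∈ with onSide (side x) e in oe
      ... | false = inj₂ z≤n
      ... | true with adj (colour e) x (tail e) in a
      ...   | true  = inj₁ (x-detour b e∈ (Eq.trans (tail-side e e∈ (sym (eqᵇ⇒≡ oe))) (sym sy)) a)
        where tail-side : ∀ e → e ∈ edges W → side (head e) ≡ side x → side (tail e) ≡ not (side x)
              tail-side e e∈ p = not-flip (Eq.trans (sym p) (adj-side _ _ _ (edge-adj W e∈)))
      ...   | false = inj₂ (≤-trans (≤-reflexive (*-identityˡ h)) (≤-trans (degree k p) (≤-trans (≤-reflexive tails) onto)))
        where
        k = colour e
        p = tail e
        sp : side p ≡ side y
        sp = Eq.trans (not-flip (Eq.trans (eqᵇ⇒≡ oe) (adj-side _ _ _ (edge-adj W e∈)))) (sym sy)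
        tails : count (onV (adj k p)) Stock ≡ count (adj k p ∘ tail) (cycle b)
        tails = Eq.trans (sym (inner b (adj k p) (Eq.trans (adj-sym k p x) a) (same-side sp)))
          (Eq.trans (count-tails (adj k p) W) (+-comm (count (adj k p ∘ tail) (edges W)) _))
        onto : count (adj k p ∘ tail) (cycle b) ≤ count (λ e′ → R e′ e) (cycle b)
        onto = count-mono (cycle b) λ { {e′} e′∈ r → both (eqᵇ-≡ (sym (head-side e′ e′∈ (adj-side _ _ _ r)))) r }
          where
          both : ∀ {i j} → i ≡ true → j ≡ true → (i ∧ j) ≡ true
          both refl refl = refl
          head-side : ∀ e′ → e′ ∈ cycle b → side (tail e′) ≡ not (side p) → side (head e′) ≡ side y
          head-side _ (here refl) _ = sw
          head-side e′ (there i) q = Eq.trans (adj-side _ _ _ (edge-adj W i)) (Eq.trans (cong not q) (Eq.trans (not-involutive _) sp))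
      Upper Lower : Set
      Upper = ∀ {e} → e ∈ cycle b → count (R e) (edges W) + count (D e) xs ≤ # (onY e) * m
      Lower = ∀ {e} → e ∈ edges W → # (onSide (side x) e) * h ≤ count (λ e′ → R e′ e) (cycle b)
      -- One `c`-neighbour of `x` is `y` itself; `2 ≤ h` provides another one, which lies on the
      -- cycle.
      located : ∃ λ e → e ∈ cycle b × adj c x (head e) ≡ true
      located with count-pos (onV (adj c x)) xs
        (s≤s⁻¹ (≤-trans 2≤h (≤-trans (degree c x) (≤-reflexive (Eq.trans (sym (inner-y b (adj c x) no-loop)) (cong (λ z → # z + count (onV (adj c x)) xs) xy))))))
      ... | ι q , q∈ , xq with head-edge W q∈
      ...   | inj₁ refl            = _ , here refl , xq
      ...   | inj₂ (e , e∈ , refl) = e , there e∈ , xq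
      M : Edge → Bool
      M e = onY e ∧ adj (colour e) x y
      y-degree : ∀ e → # (onY e) * h ≤ count (D e) xs + # (M e)
      y-degree e with onY e
      ... | false = z≤n
      ... | true  = ≤-trans (≤-reflexive (*-identityˡ h)) (≤-trans (degree (colour e) y) (≤-reflexive
        (Eq.trans (sym (inner-x b (adj (colour e) y) no-loop))
          (Eq.trans (+-comm (# (adj (colour e) y x)) _) (cong (λ z → count (onV (adj (colour e) y)) xs + # z) (adj-sym (colour e) y x))))))
      n≡ : suc m ≡ n
      n≡ = sym (inner-side-x b)
      cY : count onY (cycle b) ≡ m
      cY = suc-injective (Eq.trans (cong suc (sym (count-heads (eqᵇ (side y) ∘ side) W))) (Eq.trans (sym (inner-side-y b)) (sym n≡)))
      cX : count (onSide (side x)) (edges W) ≡ m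
      cX = sym (count-heads′ (eqᵇ (side x) ∘ side) W (eqᵇ-≡not (Eq.trans sw sy)))
      ∧-true : ∀ {i j} → i ≡ true → j ≡ false → (i ∧ j) ≡ false
      ∧-true refl refl = refl
      ∧-left : ∀ {i j} → (i ∧ j) ≡ true → i ≡ true
      ∧-left {true} _ = refl
      ΣA = sumBy (λ e → count (R e) (edges W)) (cycle b)
      ΣD = sumBy (λ e → count (D e) xs) (cycle b)
      combine : Win ⊎ Upper → Win ⊎ Lower → Win
      combine (inj₁ v) _        = v
      combine (inj₂ _) (inj₁ v) = v
      combine (inj₂ upper) (inj₂ lower) = finish located
        where
        A≥ : m * h ≤ ΣA
        A≥ = subst₂ _≤_ (Eq.trans (sumBy-const h (onSide (side x)) (edges W)) (cong (_* h) cX))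
               (sym (sumBy-swap R (cycle b) (edges W))) (sumBy-mono (edges W) lower)
        D≥ : m * h ≤ ΣD + count M (cycle b)
        D≥ = subst₂ _≤_ (Eq.trans (sumBy-const h onY (cycle b)) (cong (_* h) cY))
               (Eq.trans (sumBy-+ (λ e → count (D e) xs) (# ∘ M) (cycle b)) (cong (ΣD +_) (sumBy-# M (cycle b))))
               (sumBy-mono (cycle b) (λ {e} _ → y-degree e))
        AD≤ : ΣA + ΣD ≤ m * m
        AD≤ = subst₂ _≤_ (sumBy-+ (λ e → count (R e) (edges W)) (λ e → count (D e) xs) (cycle b))
               (Eq.trans (sumBy-const m onY (cycle b)) (cong (_* m) cY)) (sumBy-mono (cycle b) upper)
        finish : (∃ λ e → e ∈ cycle b × adj c x (head e) ≡ true) → Win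
        finish (e , e∈ , xq) with adj (colour e) x y in a
        ... | true  = y-detour b e∈ xq a
        -- Here m is n - 1. The degrees give 2mh ≥ m(m + 1) against the upper bound m · m plus the
        -- number of edges in `M`, so all m edges ending on the side of `y` would have to be in `M`;
        -- but `e` is not.
        ... | false = ⊥-elim (1+n≰n (begin
            suc (m * m + count M (cycle b))                   ≡⟨ sym (+-suc (m * m) _) ⟩
            m * m + suc (count M (cycle b))                   ≤⟨ +-monoʳ-≤ (m * m) (≤-trans M< (≤-reflexive cY)) ⟩
            m * m + m                                         ≡⟨ solve 1 (λ m → m :* m :+ m := m :* (con 1 :+ m)) refl m ⟩
            m * suc m                                         ≤⟨ *-monoʳ-≤ m (≤-trans (≤-reflexive n≡) n≤2h) ⟩
            m * (h + h)                                       ≡⟨ *-distribˡ-+ m h h ⟩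
            m * h + m * h                                     ≤⟨ +-mono-≤ A≥ D≥ ⟩
            ΣA + (ΣD + count M (cycle b))                     ≡⟨ sym (+-assoc ΣA ΣD _) ⟩
            ΣA + ΣD + count M (cycle b)                       ≤⟨ +-monoˡ-≤ _ AD≤ ⟩
            m * m + count M (cycle b)                         ∎))
          where
          open ≤-Reasoning
          open +-*-Solver
          onY-e : onY e ≡ true
          onY-e = eqᵇ-≡ (sym (Eq.trans (adj-side c x _ xq) (sym sy)))
          M< : suc (count M (cycle b)) ≤ count onY (cycle b)
          M< = count-strict (cycle b) ∧-left e∈ (∧-true onY-e a) onY-e

  -- Heavy pairs: winning from a cycle or a path that misses one.

  multiplicity : V → V → ℕ
  multiplicity x y = count (onC (λ d → adj d x y)) Stock

  -- At least n - 1 colours, written without subtraction.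
  Heavy : V → V → Set
  Heavy x y = n ≤ suc (multiplicity x y)

  heavy-sym : ∀ {x y} → Heavy x y → Heavy y x
  heavy-sym {x} {y} = subst (λ z → n ≤ suc z) (count-cong (λ { (ι _) → refl ; (κ d) → adj-sym d x y }) Stock)

  -- If xy has the colour of an edge of the cycle and x has a neighbour on that edge in the colour
  -- missing on the cycle, that edge can be replaced by a detour ending in y.
  win-heavy-cycle : 2 ≤ h → ∀ {x y c} → AvoidingCycle x y c → Heavy x y → Win
  win-heavy-cycle 2≤h {x} {y} {c} b@(mkCycle {w} {t} {d} {xs} W cl perm sy sw st) heavy with adj c x y in xy
  -- This case needs the averaging argument: `y` is then a `c`-neighbour of `x`, and too few others
  -- may be left on the cycle for the count below.
  ... | true = win-edge-and-cycle xy 2≤h b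
  ... | false with pigeonhole M near (λ _ → true) (edges W) (λ _ _ → refl) (λ _ _ → refl)
    where
    M near : Edge → Bool
    M e = adj (colour e) x y
    near e = adj c x (tail e) ∨ adj c x (head e)
  ...   | inj₁ ((p , k , q) , e∈ , xyk , xpq) = detour (split W e∈) (adj c x p) refl
    where
    ∨-right : ∀ {i j} → i ≡ false → (i ∨ j) ≡ true → j ≡ true
    ∨-right refl e = e
    arrange = λ (as bs : List Item) → Bag.solve 7 (λ x y c k d as bs →
      k Bag.⊕ (y Bag.⊕ (c Bag.⊕ (x Bag.⊕ (d Bag.⊕ (bs Bag.⊕ as))))) Bag.⊜ x Bag.⊕ (y Bag.⊕ (c Bag.⊕ (d Bag.⊕ (as Bag.⊕ (k Bag.⊕ bs))))))
      ↭-refl [ ι x ] [ ι y ] [ κ c ] [ κ k ] [ κ d ] as bs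
    arrange′ = λ (as bs : List Item) → Bag.solve 7 (λ x y c k d as bs →
      k Bag.⊕ (y Bag.⊕ (c Bag.⊕ (x Bag.⊕ (d Bag.⊕ (as Bag.⊕ bs))))) Bag.⊜ x Bag.⊕ (y Bag.⊕ (c Bag.⊕ (d Bag.⊕ (as Bag.⊕ (k Bag.⊕ bs))))))
      ↭-refl [ ι x ] [ ι y ] [ κ c ] [ κ k ] [ κ d ] as bs
    detour : Split W (p , k , q) → ∀ i → adj c x p ≡ i → Win
    detour (mkSplit {as} {bs} W₁ l W₂ refl _) true xp =
      win (join k (path (end y)) (adj′ xyk) (join c (path (end x)) xp (join d (rev (path W₁)) (adj′ cl) (rev (path W₂)))))
        (↭-trans (arrange′ as bs) perm)
    detour (mkSplit {as} {bs} W₁ l W₂ refl _) false xp =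
      win (join k (path (end y)) (adj′ xyk) (join c (path (end x)) (∨-right xp xpq) (join d (path W₂) cl (path W₁))))
        (↭-trans (arrange as bs) perm)
  ...   | inj₂ (le , _) = decide (adj d x y) refl (adj c x w) refl
    where
    M near : Edge → Bool
    M e = adj (colour e) x y
    near e = adj c x (tail e) ∨ adj c x (head e)
    F = count M (edges W)
    G = count near (edges W)
    L = count (λ _ → true) (edges W)
    Dg = count (onV (adj c x)) xs
    F≥ : n ≤ suc (# (adj d x y) + F)
    F≥ = ≤-trans heavy (≤-reflexive (cong suc (Eq.trans (sym (count-↭ (onC (λ d → adj d x y)) perm))
           (cong₂ (λ i j → # i + (# (adj d x y) + j)) xy (count-colours (λ d → adj d x y) W)))))
    D≥ : h ≤ Dg
    D≥ = ≤-trans (degree c x) (≤-reflexive (sym (inner b (adj c x) no-loop xy)))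
    exclusive : ∀ {e} → e ∈ edges W → adj c x (tail e) ≡ true → adj c x (head e) ≡ false
    exclusive {e} e∈ xp with adj c x (head e) in xq
    ... | false = refl
    ... | true  = ⊥-elim (true≢false (edge-adj W e∈) (same-side (Eq.trans (adj-side c x _ xp) (sym (adj-side c x _ xq)))))
    -- Each `c`-neighbour of `x` on the cycle lies on two edges of `W`, except that the start `w`
    -- lies on one; `t` is on the side of `x` and is no neighbour.
    G≥ : G + # (adj c x w) ≡ Dg + Dg
    G≥ = Eq.trans (cong (_+ # (adj c x w)) (count-∨ (adj c x ∘ tail) (adj c x ∘ head) (edges W) exclusive))
      (Eq.trans (+-assoc (count (adj c x ∘ tail) (edges W)) _ _) (cong₂ _+_ (sym (count-tails′ (adj c x) W (same-side (sym st))))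
        (Eq.trans (+-comm (count (adj c x ∘ head) (edges W)) _) (sym (count-heads (adj c x) W)))))
    L≡ : suc (suc (suc L)) ≡ n + n
    L≡ = Eq.trans (cong (λ z → suc (suc (suc z))) (sym (count-colours (λ _ → true) W)))
      (Eq.trans (cong suc (count-↭ (onC (λ _ → true)) perm)) colours-size)
    contra : ∀ i j → i + j ≤ 1 → n ≤ suc (i + F) → G + j ≡ Dg + Dg → ⊥
    contra i j ij p q = 1+n≰n (begin
      suc (suc (suc L))       ≡⟨ L≡ ⟩
      n + n                   ≤⟨ +-mono-≤ p (≤-trans n≤2h (≤-trans (+-mono-≤ D≥ D≥) (≤-reflexive (sym q)))) ⟩
      suc (i + F) + (G + j)   ≡⟨ solve 4 (λ i j F G → con 1 :+ (i :+ F) :+ (G :+ j) := con 1 :+ ((i :+ j) :+ (F :+ G))) refl i j F G ⟩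
      suc (i + j + (F + G))   ≤⟨ s≤s (+-mono-≤ ij le) ⟩
      suc (suc L)             ∎)
      where open ≤-Reasoning
            open +-*-Solver
    decide : ∀ i → adj d x y ≡ i → ∀ j → adj c x w ≡ j → Win
    -- The closing edge is not in `edges W`; in this case it is itself the edge to be replaced.
    -- Otherwise at most one of the two corrections `i`, `j` applies, which the count can afford.
    decide true  dxy true  cxw = win (join d (path (end y)) (adj′ dxy) (join c (path (end x)) cxw (path W)))
      (↭-trans (Bag.solve 5 (λ x y c d xs → d Bag.⊕ (y Bag.⊕ (c Bag.⊕ (x Bag.⊕ xs))) Bag.⊜ x Bag.⊕ (y Bag.⊕ (c Bag.⊕ (d Bag.⊕ xs)))) ↭-refl
        [ ι x ] [ ι y ] [ κ c ] [ κ d ] xs) perm)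
    decide true  p false q = ⊥-elim (contra 1 0 ≤-refl (subst (λ z → n ≤ suc (# z + F)) p F≥) (subst (λ z → G + # z ≡ Dg + Dg) q G≥))
    decide false p true  q = ⊥-elim (contra 0 1 ≤-refl (subst (λ z → n ≤ suc (# z + F)) p F≥) (subst (λ z → G + # z ≡ Dg + Dg) q G≥))
    decide false p false q = ⊥-elim (contra 0 0 z≤n (subst (λ z → n ≤ suc (# z + F)) p F≥) (subst (λ z → G + # z ≡ Dg + Dg) q G≥))

  size-AvoidingPath : ∀ {x y w t α β} (q : AvoidingPath x y w t α β) → n ≡ suc (count (onSide (side x)) (edges (AvoidingPath.walk q)))
  size-AvoidingPath {x} {y} (mkPath {xs} W perm sy sw st) = Eq.trans (sym (side-size (side x)))
    (Eq.trans (sym (count-↭ (onV (eqᵇ (side x) ∘ side)) perm))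
      (Eq.trans (cong₂ (λ a b → # a + (# b + count (onV (eqᵇ (side x) ∘ side)) xs)) (eqᵇ-refl (side x)) (eqᵇ-≡not sy))
        (cong suc (count-heads′ (eqᵇ (side x) ∘ side) W (eqᵇ-≡not (Eq.trans sw sy))))))

  -- A Pósa rotation at `w`: the edge from `w` spends `α`, and dropping `e` frees its colour.
  reroute : ∀ {x y w t α β} (q : AvoidingPath x y w t α β) {e} → e ∈ edges (AvoidingPath.walk q) → side (head e) ≡ side x →
    adj α w (head e) ≡ true → AvoidingPath x y (tail e) t β (colour e)
  reroute {x} {y} {α = α} {β = β} (mkPath W perm sy sw st) {e} e∈ se a with split W e∈
  ... | mkSplit {as} {bs} W₁ l W₂ refl _ = avoidingPath (join α (rev (path W₁)) a (path W₂))
    (↭-trans (Bag.solve 7 (λ x y a b k as bs →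
       x Bag.⊕ (y Bag.⊕ (b Bag.⊕ (k Bag.⊕ (a Bag.⊕ (as Bag.⊕ bs))))) Bag.⊜ x Bag.⊕ (y Bag.⊕ (a Bag.⊕ (b Bag.⊕ (as Bag.⊕ (k Bag.⊕ bs))))))
       ↭-refl [ ι x ] [ ι y ] [ κ α ] [ κ β ] [ κ (colour e) ] as bs) perm)
    sy (Eq.trans (not-flip (adj-side _ _ _ l)) (Eq.trans (cong not se) (sym sy))) st

  module _ (2≤h : 2 ≤ h) where

    -- Of the 2n - 3 edges of the walk n - 1 end on the side of `x` and only n - 2 on the other. If
    -- `x y` has neither `α` nor `β`, one of its n - 1 colours therefore sits on an edge ending on
    -- the side of `x`, and `cover` offers a way to bypass that edge.
    win-tied : ∀ {x y w t α β} (q : AvoidingPath x y w t α β) → Tied x y w t α β (edges (AvoidingPath.walk q)) → Heavy x y → Win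
    win-tied {x} {y} {w} {t} {α} {β} q@(mkPath {xs} W perm sy sw st) (mkTied xα xβ yα yβ cover) heavy =
      decide (adj α x y) refl (adj β x y) refl
      where
      M : Edge → Bool
      M e = adj (colour e) x y
      enter : ∀ {γ δ} → ι x ∷ ι y ∷ κ γ ∷ κ δ ∷ xs ↭ Stock → adj γ x y ≡ true → adj δ w x ≡ true → Win
      enter {γ} {δ} p xy wx = win (join γ (path (end y)) (adj′ xy) (join δ (path (end x)) (adj′ wx) (path W)))
        (↭-trans (Bag.solve 5 (λ x y c d xs → c Bag.⊕ (y Bag.⊕ (d Bag.⊕ (x Bag.⊕ xs))) Bag.⊜ x Bag.⊕ (y Bag.⊕ (c Bag.⊕ (d Bag.⊕ xs)))) ↭-refl
          [ ι x ] [ ι y ] [ κ γ ] [ κ δ ] xs) p)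
      along : ∀ {e} → e ∈ edges W → M e ≡ true → adj β t (tail e) ≡ true → Win
      along {e} e∈ xy tp with split W e∈
      ... | mkSplit {as} {bs} W₁ l W₂ items-eq _ =
        win (join (colour e) (path (end y)) (adj′ xy) (join α (path (end x)) (adj′ xα) (join β (path W₁) (adj′ tp) (rev (path W₂)))))
          (↭-trans (Bag.solve 7 (λ x y a b k as bs →
            k Bag.⊕ (y Bag.⊕ (a Bag.⊕ (x Bag.⊕ (b Bag.⊕ (as Bag.⊕ bs))))) Bag.⊜ x Bag.⊕ (y Bag.⊕ (a Bag.⊕ (b Bag.⊕ (as Bag.⊕ (k Bag.⊕ bs))))))
            ↭-refl [ ι x ] [ ι y ] [ κ α ] [ κ β ] [ κ (colour e) ] as bs)
            (subst (λ z → ι x ∷ ι y ∷ κ α ∷ κ β ∷ z ↭ Stock) items-eq perm))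
      through : ∀ {e} → e ∈ edges W → M e ≡ true → side (head e) ≡ side x → adj α w (head e) ≡ true → Win
      through {e} e∈ xy se a with reroute q e∈ se a
      ... | q′ with classify q′
      ...   | inj₁ v                     = v
      ...   | inj₂ (inj₁ (_ , b))        = win-heavy-cycle 2≤h b heavy
      ...   | inj₂ (inj₂ (inj₂ tied))    = ⊥-elim (true≢false (Tied′.y-α tied) yβ)
      ...   | inj₂ (inj₂ (inj₁ tied))    = win (join (colour e) (path (end y)) (adj′ xy) (join β (path (end x)) (adj′ (Tied.x-α tied)) (path (AvoidingPath.walk q′))))
        (↭-trans (Bag.solve 5 (λ x y c d xs → d Bag.⊕ (y Bag.⊕ (c Bag.⊕ (x Bag.⊕ xs))) Bag.⊜ x Bag.⊕ (y Bag.⊕ (c Bag.⊕ (d Bag.⊕ xs)))) ↭-refl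
          [ ι x ] [ ι y ] [ κ β ] [ κ (colour e) ] (AvoidingPath.items q′)) (AvoidingPath.perm q′))
      S# = count (onSide (side x)) (edges W)
      T# = count (not ∘ onSide (side x)) (edges W)
      few-others : suc T# ≡ S#
      few-others = +-cancelˡ-≡ (suc (suc S#)) _ _ (begin
          suc (suc S#) + suc T#                                 ≡⟨ +-suc (suc (suc S#)) T# ⟩
          suc (suc (suc (S# + T#)))                             ≡⟨ cong (λ z → suc (suc (suc z))) (Eq.trans (count-not (onSide (side x)) (edges W)) (sym (count-colours (λ _ → true) W))) ⟩
          suc (suc (suc (count (onC (λ _ → true)) xs)))         ≡⟨ cong suc (count-↭ (onC (λ _ → true)) perm) ⟩
          suc (count (onC (λ _ → true)) Stock)                    ≡⟨ colours-size ⟩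
          n + n                                                 ≡⟨ cong₂ _+_ (size-AvoidingPath q) (size-AvoidingPath q) ⟩
          suc S# + suc S#                                       ≡⟨ +-suc (suc S#) S# ⟩
          suc (suc S#) + S#                                     ∎)
        where open ≡-Reasoning
      many : ∀ {i j} → adj α x y ≡ i → adj β x y ≡ j → n ≤ suc (# i + (# j + count M (edges W)))
      many p r = ≤-trans heavy (≤-reflexive (cong suc (Eq.trans (sym (count-↭ (onC (λ d → adj d x y)) perm))
        (cong₂ _+_ (cong # p) (cong₂ _+_ (cong # r) (count-colours (λ d → adj d x y) W))))))
      decide : ∀ i → adj α x y ≡ i → ∀ j → adj β x y ≡ j → Win
      decide true  p _     _ = enter perm p xβ
      decide false p true  r = enter (AvoidingPath.perm (recoloured q)) r xα
      decide false p false r with separate M (not ∘ onSide (side x)) (edges W)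
        (subst (_≤ count M (edges W)) (sym few-others) (s≤s⁻¹ (subst (_≤ suc (count M (edges W))) (size-AvoidingPath q) (many p r))))
      ... | e , e∈ , xy , ns with cover e∈ (sym (eqᵇ⇒≡ (not-false ns)))
        where not-false : ∀ {i} → not i ≡ false → i ≡ true
              not-false {true} _ = refl
      ...   | inj₁ a = through e∈ xy (sym (eqᵇ⇒≡ (not-false ns))) a
        where not-false : ∀ {i} → not i ≡ false → i ≡ true
              not-false {true} _ = refl
      ...   | inj₂ a = along e∈ xy a

    -- If the tie is at `y`, the path is read backwards. A tie on the far side of the reversed path
    -- is then impossible, since it denies the edge `t y` that the first tie asserts.
    win-heavy-path : ∀ {x y w t α β} → AvoidingPath x y w t α β → Heavy x y → Win
    win-heavy-path q heavy with classify q
    ... | inj₁ v                   = v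
    ... | inj₂ (inj₁ (_ , b))      = win-heavy-cycle 2≤h b heavy
    ... | inj₂ (inj₂ (inj₁ tied))  = win-tied q tied heavy
    ... | inj₂ (inj₂ (inj₂ tied))  with classify (reversed q)
    ...   | inj₁ v                    = v
    ...   | inj₂ (inj₁ (_ , b))       = win-heavy-cycle 2≤h b (heavy-sym heavy)
    ...   | inj₂ (inj₂ (inj₁ tied′))  = win-tied (reversed q) tied′ (heavy-sym heavy)
    ...   | inj₂ (inj₂ (inj₂ tied′))  = ⊥-elim (true≢false (Tied′.y-α tied) (Tied′.x-α tied′))

  -- Existence of heavy pairs, and the path that misses a single vertex.

  module _ (2≤h : 2 ≤ h) (3≤n : 3 ≤ n) where

    heavyᵇ : V → V → Bool
    heavyᵇ y z = n ≤ᵇ suc (multiplicity z y)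

    heavyᵇ⇒ : ∀ {y z} → heavyᵇ y z ≡ true → Heavy z y
    heavyᵇ⇒ {y} {z} eq = ≤ᵇ⇒≤ n _ (subst T (sym eq) tt)

    heavy-side : ∀ {y z} → Heavy z y → side z ≡ not (side y)
    heavy-side {y} {z} heavy with count-pos (onC (λ d → adj d z y)) Stock (≤-trans (s≤s z≤n) (s≤s⁻¹ (≤-trans 3≤n heavy)))
    ... | κ d , _ , zy = not-flip (adj-side d z y zy)

    -- The multiplicities at `y` sum to at least (2n - 1)h. A light opposite vertex contributes at
    -- most n - 2 (the `k` below), a heavy one at most 2n - 1, which is k + 3 more. With at most one
    -- heavy vertex the sum is at most n² - n + 1, and twice this falls short of (2n - 1)n by n - 2,
    -- which is positive for n ≥ 3.
    many-heavy : ∀ y → 2 ≤ count (onV (heavyᵇ y)) Stock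
    many-heavy y = bound 3≤n refl (count (onV (heavyᵇ y)) Stock) refl
      where
      R : Item → Item → Bool
      R (ι z) (κ d) = adj d z y
      R _     _     = false
      N = count (onC (λ _ → true)) Stock
      lower : N * h ≤ sumBy (λ i → count (R i) Stock) Stock
      lower = subst₂ _≤_ (sumBy-const h (onC (λ _ → true)) Stock) (sym (sumBy-swap R Stock Stock))
        (sumBy-mono Stock λ { {ι _} _ → z≤n ; {κ d} _ → ≤-trans (≤-reflexive (*-identityˡ h)) (≤-trans (degree d y)
          (≤-reflexive (count-cong (λ { (ι z) → adj-sym d y z ; (κ _) → refl }) Stock))) })
      opposite : Item → Bool
      opposite = onV (eqᵇ (not (side y)) ∘ side)
      bound : ∀ {m} → 3 ≤ m → n ≡ m → ∀ b → count (onV (heavyᵇ y)) Stock ≡ b → 2 ≤ b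
      bound {suc zero} (s≤s ()) _ _ _
      bound {suc (suc zero)} (s≤s (s≤s ())) _ _ _
      bound {suc (suc (suc j))} _ n≡ b b≡ with 2 ≤? b
      ... | yes 2≤b = 2≤b
      ... | no  2≰b = ⊥-elim (1+n≰n (begin
          suc (2 * (n * k + 1 * (k + 3)))          ≡⟨ cong (λ n → suc (2 * (n * k + 1 * (k + 3)))) n≡ ⟩
          suc (2 * ((2 + k) * k + 1 * (k + 3)))    ≤⟨ m≤m+n _ j ⟩
          suc (2 * ((2 + k) * k + 1 * (k + 3))) + j
            ≡⟨ solve 1 (λ j → con 1 :+ con 2 :* ((con 3 :+ j) :* (con 1 :+ j) :+ con 1 :* ((con 1 :+ j) :+ con 3)) :+ j
                          := ((con 1 :+ j) :+ ((con 1 :+ j) :+ con 3)) :* (con 3 :+ j)) refl j ⟩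
          (k + (k + 3)) * (2 + k)                  ≡⟨ sym (cong₂ _*_ N≡ n≡) ⟩
          N * n                                    ≤⟨ *-monoʳ-≤ N n≤2h ⟩
          N * (h + h)                              ≡⟨ *-distribˡ-+ N h h ⟩
          N * h + N * h                            ≤⟨ +-mono-≤ upper upper ⟩
          U + U                                    ≡⟨ cong (U +_) (sym (+-identityʳ U)) ⟩
          2 * U                                    ≤⟨ *-monoʳ-≤ 2 (+-monoʳ-≤ (n * k) (*-monoˡ-≤ (k + 3) (s≤s⁻¹ (≰⇒> 2≰b)))) ⟩
          2 * (n * k + 1 * (k + 3))                ∎))
        where
        open ≤-Reasoning
        open +-*-Solver
        k = suc j
        U = n * k + b * (k + 3)
        N≡ : N ≡ k + (k + 3)
        N≡ = suc-injective (Eq.trans colours-size (Eq.trans (cong₂ _+_ n≡ n≡)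
          (solve 1 (λ j → (con 3 :+ j) :+ (con 3 :+ j) := con 1 :+ ((con 1 :+ j) :+ ((con 1 :+ j) :+ con 3))) refl j)))
        each : ∀ i → count (R i) Stock ≤ # (opposite i) * k + # (onV (heavyᵇ y) i) * (k + 3)
        each (κ d) = ≤-trans (≤-reflexive (count-zero (λ _ → refl) Stock)) z≤n
        each (ι z) = ≤-trans (≤-reflexive (count-cong (λ { (ι _) → refl ; (κ _) → refl }) Stock)) (go (heavyᵇ y z) refl (eqᵇ (not (side y)) (side z)) refl)
          where
          go : ∀ i → heavyᵇ y z ≡ i → ∀ o → eqᵇ (not (side y)) (side z) ≡ o → multiplicity z y ≤ # o * k + # i * (k + 3)
          go true  hv true  _  = ≤-trans (count-mono Stock (λ { {κ _} _ _ → refl })) (≤-reflexive (Eq.trans N≡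
            (sym (cong₂ _+_ (*-identityˡ k) (*-identityˡ (k + 3))))))
          go true  hv false o≡ = ⊥-elim (true≢false (eqᵇ-≡ (sym (heavy-side (heavyᵇ⇒ hv)))) o≡)
          go false hv true  _  = ≤-trans (s≤s⁻¹ (s≤s⁻¹ (subst (suc (suc (multiplicity z y)) ≤_) n≡ (≰⇒> light))))
              (≤-reflexive (sym (Eq.trans (+-identityʳ _) (*-identityˡ k))))
            where light : ¬ (n ≤ suc (multiplicity z y))
                  light le = subst T hv (≤⇒≤ᵇ le)
          go false hv false o≡ = ≤-reflexive (count-zero (λ { (ι _) → refl ; (κ d) → no-edge d }) Stock)
            where no-edge : ∀ d → adj d z y ≡ false
                  no-edge d with adj d z y in a
                  ... | false = refl
                  ... | true  = ⊥-elim (true≢false (eqᵇ-≡ (sym (not-flip (adj-side d z y a)))) o≡)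
        upper : N * h ≤ U
        upper = ≤-trans lower (≤-trans (sumBy-mono Stock (λ {i} _ → each i)) (≤-reflexive
          (Eq.trans (sumBy-+ (λ i → # (opposite i) * k) _ Stock) (cong₂ _+_
            (Eq.trans (sumBy-const k opposite Stock) (cong (_* k) (side-size (not (side y)))))
            (Eq.trans (sumBy-const (k + 3) (onV (heavyᵇ y)) Stock) (cong (_* (k + 3)) b≡))))))

    two-heavy : ∀ y → ∃ λ z₁ → ∃ λ z₂ → ∃ λ rest → Stock ↭ ι z₁ ∷ ι z₂ ∷ rest × Heavy z₁ y × Heavy z₂ y
    two-heavy y with count-pos f Stock (≤-trans (s≤s z≤n) (many-heavy y))
      where f = onV (heavyᵇ y)
    ... | ι z₁ , z₁∈ , h₁ with extract z₁∈
    ... | ys , p with count-pos (onV (heavyᵇ y)) ys (s≤s⁻¹ (≤-trans (many-heavy y)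
          (≤-reflexive (Eq.trans (count-↭ (onV (heavyᵇ y)) p) (cong (λ b → # b + count (onV (heavyᵇ y)) ys) h₁)))))
    ... | ι z₂ , z₂∈ , h₂ with extract z₂∈
    ... | rest , q = z₁ , z₂ , rest , ↭-trans p (prep _ q) , heavyᵇ⇒ h₁ , heavyᵇ⇒ h₂

    -- A cycle avoiding x and y is cut at z, and x is put in its place.
    replace : ∀ {x y z p c k xs} → Heavy z y → Walk z p xs → adj k p z ≡ true →
      ι x ∷ ι y ∷ κ c ∷ κ k ∷ xs ↭ Stock → side y ≡ not (side x) → side z ≡ side x → Win
    replace _ (end _) pz _ _ _ = ⊥-elim (true≢false pz no-loop)
    replace {x} {y} {z} {p} {c} {k} heavy (step _ g {w} {xs = xs} zw W) pz perm sy sz =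
      decide (adj c x y) refl (adj k w x) refl (adj c x p) refl
      where
      sw : side w ≡ side y
      sw = Eq.trans (adj-side g z w zw) (Eq.trans (cong not sz) (sym sy))
      sp : side p ≡ side y
      sp = Eq.trans (not-flip (adj-side k p z pz)) (Eq.trans (cong not sz) (sym sy))
      syz : side y ≡ not (side z)
      syz = Eq.trans sy (cong not (sym sz))
      decide : ∀ i → adj c x y ≡ i → ∀ j → adj k w x ≡ j → ∀ l → adj c x p ≡ l → Win
      decide true xy _ _ _ _ = win-edge-and-cycle xy 2≤h (avoidingCycle (rev (path (step z g zw W))) (adj′ pz) perm sy sp sz)
      decide false xy true wx _ _ = win-heavy-path 2≤h {z} {y} {p} {x} {c} {g} (avoidingPath (join k (rev (path W)) wx (path (end x)))
        (↭-trans (Bag.solve 7 (λ x y z c k g xs → z Bag.⊕ (y Bag.⊕ (c Bag.⊕ (g Bag.⊕ (k Bag.⊕ (xs Bag.⊕ x))))) Bag.⊜ x Bag.⊕ (y Bag.⊕ (c Bag.⊕ (k Bag.⊕ (z Bag.⊕ (g Bag.⊕ xs))))))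
          ↭-refl [ ι x ] [ ι y ] [ ι z ] [ κ c ] [ κ k ] [ κ g ] xs) perm) syz sp (sym sz)) heavy
      decide false xy false wx true xp = win-heavy-path 2≤h {z} {y} {w} {x} {k} {g} (avoidingPath (join c (path W) (adj′ xp) (path (end x)))
        (↭-trans (Bag.solve 7 (λ x y z c k g xs → z Bag.⊕ (y Bag.⊕ (k Bag.⊕ (g Bag.⊕ (c Bag.⊕ (xs Bag.⊕ x))))) Bag.⊜ x Bag.⊕ (y Bag.⊕ (c Bag.⊕ (k Bag.⊕ (z Bag.⊕ (g Bag.⊕ xs))))))
          ↭-refl [ ι x ] [ ι y ] [ ι z ] [ κ c ] [ κ k ] [ κ g ] xs) perm) syz sw (sym sz)) heavy
      decide false xy false wx false xp
        with cross W (adj k w) (adj c x) (side x)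
           (λ q a → Eq.trans (adj-side k w q a) (Eq.trans (cong not (Eq.trans sw sy)) (not-involutive _)))
           (λ q a → adj-side c x q a)
      ... | inj₁ ((q , l , r) , e∈ , wr , xq) = found (split W e∈)
        where
        found : Split W (q , l , r) → Win
        found (mkSplit {as} {bs} W₁ _ W₂ refl _) = win-heavy-path 2≤h {z} {y} {p} {x} {g} {l}
          (avoidingPath (rev (join c (path (end x)) xq (join k (rev (path W₁)) wr (path W₂))))
          (↭-trans (Bag.solve 9 (λ x y z c k g l as bs →
             z Bag.⊕ (y Bag.⊕ (g Bag.⊕ (l Bag.⊕ (c Bag.⊕ (x Bag.⊕ (k Bag.⊕ (as Bag.⊕ bs))))))) Bag.⊜ x Bag.⊕ (y Bag.⊕ (c Bag.⊕ (k Bag.⊕ (z Bag.⊕ (g Bag.⊕ (as Bag.⊕ (l Bag.⊕ bs))))))))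
             ↭-refl [ ι x ] [ ι y ] [ ι z ] [ κ c ] [ κ k ] [ κ g ] [ κ l ] as bs) perm) syz sp (sym sz)) heavy
      -- Both `x` and `z` are off the walk, so `R` is n - 2. Only `w` can lose a neighbour to `z`,
      -- which lies on the side of `x`; hence the count still exceeds `R`.
      ... | inj₂ (le , _) = ⊥-elim (1+n≰n (≤-trans bound (subst₂ _≤_ left right le)))
        where
        F = count (onV (adj k w)) xs
        G = count (onV (adj c x)) xs
        R = count (onV (eqᵇ (side x) ∘ side)) xs
        left : F + G + # (eqᵇ (side x) (side w)) ≡ F + G
        left = Eq.trans (cong (λ b → F + G + # b) (eqᵇ-≡not (Eq.trans sw sy))) (+-identityʳ _)
        right : R + (# (adj k w w) + # (adj c x p)) ≡ R
        right = Eq.trans (cong₂ (λ a b → R + (# a + # b)) (no-loop {k} {w}) xp) (+-identityʳ _)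
        #≤1 : ∀ b → # b ≤ 1
        #≤1 true  = ≤-refl
        #≤1 false = z≤n
        F≥ : h ≤ suc F
        F≥ = ≤-trans (degree k w) (≤-trans (≤-reflexive (Eq.trans (sym (count-↭ (onV (adj k w)) perm))
          (cong₂ (λ a b → # a + (# b + (# (adj k w z) + F))) wx (same-side {k} {w} {y} sw)))) (+-monoˡ-≤ F (#≤1 (adj k w z))))
        G≥ : h ≤ G
        G≥ = ≤-trans (degree c x) (≤-reflexive (Eq.trans (sym (count-↭ (onV (adj c x)) perm))
          (Eq.trans (cong₂ (λ a b → # a + (# b + (# (adj c x z) + G))) (no-loop {c} {x}) xy)
            (cong (λ b → # b + G) (same-side {c} {x} {z} (sym sz))))))
        size : n ≡ suc (suc R)
        size = Eq.trans (sym (side-size (side x))) (Eq.trans (sym (count-↭ (onV (eqᵇ (side x) ∘ side)) perm))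
          (Eq.trans (cong₂ (λ a b → # a + (# b + (# (eqᵇ (side x) (side z)) + R))) (eqᵇ-refl (side x)) (eqᵇ-≡not sy))
            (cong (λ b → suc (# b + R)) (eqᵇ-≡ (sym sz)))))
        bound : suc R ≤ F + G
        bound = s≤s⁻¹ (≤-trans (≤-reflexive (sym size)) (≤-trans n≤2h (+-mono-≤ F≥ G≥)))

    -- Nothing is asked of the pair `x`, `y`: some `z` is heavy with `y`, and if it is not `x`, then
    -- it is on the cycle and can trade places with `x`.
    win-cycle : ∀ {x y c} → AvoidingCycle x y c → Win
    win-cycle {x} {y} {c} b@(mkCycle {w} {t} {d} {xs} W cl perm sy sw st) with two-heavy y
    ... | z , _ , _ , p , heavy , _ = locate (∈-resp-↭ (↭-sym perm) (∈-resp-↭ (↭-sym p) (here refl)))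
      where
      sz : side z ≡ side x
      sz = Eq.trans (heavy-side heavy) (sym (not-flip sy))
      locate : ι z ∈ ι x ∷ ι y ∷ κ c ∷ κ d ∷ xs → Win
      locate (here refl)                          = win-heavy-cycle 2≤h b heavy
      locate (there (here refl))                  = ⊥-elim (true≢false (eqᵇ-≡ (sym sz)) (eqᵇ-≡not sy))
      locate (there (there (there (there z∈)))) with head-edge W z∈
      ... | inj₁ refl            = ⊥-elim (true≢false (eqᵇ-≡ (sym sz)) (eqᵇ-≡not (Eq.trans sw sy)))
      ... | inj₂ (e , e∈ , refl) = rotated (split W e∈)
        where
        rotated : Split W e → Win
        rotated (mkSplit {as} {bs} W₁ l W₂ refl _) = replace heavy (joinW d W₂ cl W₁) l
          (↭-trans (Bag.solve 7 (λ x y c d k as bs →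
             x Bag.⊕ (y Bag.⊕ (c Bag.⊕ (k Bag.⊕ (bs Bag.⊕ (d Bag.⊕ as))))) Bag.⊜ x Bag.⊕ (y Bag.⊕ (c Bag.⊕ (d Bag.⊕ (as Bag.⊕ (k Bag.⊕ bs))))))
             ↭-refl [ ι x ] [ ι y ] [ κ c ] [ κ d ] [ κ (colour e) ] as bs) perm) sy sz

    -- Here the path missing only y consists of x and the walk, linked in the colour α, and β is unused.
    module _ {x y w t α β} (q : AvoidingPath x y w t α β) (tied : Tied x y w t α β (edges (AvoidingPath.walk q))) where
      open AvoidingPath q renaming (walk to W ; items to xs)
      open Tied tied

      Bad : Edge → Set
      Bad (p , k , z) = adj α w z ≡ true × adj β x p ≡ true × adj k x p ≡ true

      -- A heavy vertex z either becomes an end of the path by one rotation, which wins, or is bad.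
      good-or-bad : ∀ {e} → e ∈ edges W → Heavy (head e) y → Win ⊎ Bad e
      good-or-bad {e@(p , k , z)} e∈ heavy with split W e∈
      ... | mkSplit {as} W₁ l (end _) refl _ = inj₁ (win-heavy-path 2≤h {z} {y} {p} {x} {β} {k}
          (avoidingPath (rev (join α (path (end x)) (adj′ x-α) (path W₁)))
            (↭-trans (Bag.solve 7 (λ x y a b k z as →
               z Bag.⊕ (y Bag.⊕ (b Bag.⊕ (k Bag.⊕ (a Bag.⊕ (x Bag.⊕ as))))) Bag.⊜ x Bag.⊕ (y Bag.⊕ (a Bag.⊕ (b Bag.⊕ (as Bag.⊕ (k Bag.⊕ z))))))
               ↭-refl [ ι x ] [ ι y ] [ κ α ] [ κ β ] [ κ k ] [ ι z ] as) perm)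
            (not-flip (heavy-side heavy)) (Eq.trans (not-flip (adj-side k p z l)) (sym (not-flip (heavy-side heavy))))
            (Eq.trans (not-flip side-y) (sym (heavy-side heavy)))) heavy)
      ... | mkSplit {as} W₁ l (step _ k′ {r} {xs = bs} l′ W₃) refl _ = decide (adj β x r) refl (adj β t p) refl
        where
        syz : side y ≡ not (side z)
        syz = not-flip (heavy-side heavy)
        sz : side z ≡ side x
        sz = Eq.trans (heavy-side heavy) (sym (not-flip side-y))
        sp : side p ≡ side y
        sp = Eq.trans (not-flip (adj-side k p z l)) (sym syz)
        sr : side r ≡ side y
        sr = Eq.trans (adj-side k′ z r l′) (sym syz)
        decide : ∀ i → adj β x r ≡ i → ∀ j → adj β t p ≡ j → Win ⊎ Bad e
        -- The new path is p ... w, x, r ... t: `x` takes the place of `z`, and both colours at `z`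
        -- become free.
        decide true xr _ _ = inj₁ (win-heavy-path 2≤h {z} {y} {p} {t} {k} {k′}
          (avoidingPath (join α (rev (path W₁)) x-α (join β (path (end x)) xr (path W₃)))
            (↭-trans (Bag.solve 9 (λ x y a b k z k′ as bs →
               z Bag.⊕ (y Bag.⊕ (k Bag.⊕ (k′ Bag.⊕ (a Bag.⊕ (as Bag.⊕ (b Bag.⊕ (x Bag.⊕ bs))))))) Bag.⊜ x Bag.⊕ (y Bag.⊕ (a Bag.⊕ (b Bag.⊕ (as Bag.⊕ (k Bag.⊕ (z Bag.⊕ (k′ Bag.⊕ bs))))))))
               ↭-refl [ ι x ] [ ι y ] [ κ α ] [ κ β ] [ κ k ] [ ι z ] [ κ k′ ] as bs) perm)
            syz sp (Eq.trans side-t (sym sz))) heavy)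
        -- The new path is x, w ... p, t ... r.
        decide false _ true tp = inj₁ (win-heavy-path 2≤h {z} {y} {r} {x} {k} {k′}
          (avoidingPath (rev (join α (path (end x)) (adj′ x-α) (join β (path W₁) (adj′ tp) (rev (path W₃)))))
            (↭-trans (Bag.solve 9 (λ x y a b k z k′ as bs →
               z Bag.⊕ (y Bag.⊕ (k Bag.⊕ (k′ Bag.⊕ (a Bag.⊕ (x Bag.⊕ (b Bag.⊕ (as Bag.⊕ bs))))))) Bag.⊜ x Bag.⊕ (y Bag.⊕ (a Bag.⊕ (b Bag.⊕ (as Bag.⊕ (k Bag.⊕ (z Bag.⊕ (k′ Bag.⊕ bs))))))))
               ↭-refl [ ι x ] [ ι y ] [ κ α ] [ κ β ] [ κ k ] [ ι z ] [ κ k′ ] as bs) perm)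
            syz sr (sym sz)) heavy)
        decide false _ false tp with cover e∈ sz
        ... | inj₂ tp′ = ⊥-elim (true≢false tp′ tp)
        ... | inj₁ wz with classify (reroute q e∈ sz wz)
        ...   | inj₁ v                    = inj₁ v
        ...   | inj₂ (inj₁ (_ , b))       = inj₁ (win-cycle b)
        ...   | inj₂ (inj₂ (inj₁ tied′))  = inj₂ (wz , adj′ (Tied.x-α tied′) , adj′ (Tied.x-β tied′))
        ...   | inj₂ (inj₂ (inj₂ tied′))  = ⊥-elim (true≢false (Tied′.y-α tied′) y-β)

      -- With two bad vertices z₁ before z₂, the rotation at z₂ reverses the part containing z₁,
      -- after which the rotation at z₁ makes it an end.
      two-bad : ∀ {e₁ e₂ k′ r as bs cs} → Walk w (tail e₁) as → adj k′ (head e₁) r ≡ true →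
        Walk r (tail e₂) bs → Walk (head e₂) t cs →
        xs ↭ as ++ κ (colour e₁) ∷ ι (head e₁) ∷ κ k′ ∷ bs ++ κ (colour e₂) ∷ cs →
        Heavy (head e₁) y → Bad e₁ → Bad e₂ → Win
      two-bad {p₁ , k₁ , z₁} {p₂ , k₂ , z₂} {k′} {r} {as} {bs} {cs} W₁ l′ W₂ W₃ items-↭ heavy (_ , xp₁ , _) (wz₂ , _ , xp₂) =
        win-heavy-path 2≤h {z₁} {y} {r} {t} {k₁} {k′}
          -- The new path is r ... p₂, x, p₁ ... w, z₂ ... t, with the new links coloured `k₂`, `β`,
          -- `α`. It skips `z₁` and so frees `k₁` and `k′`.
          (avoidingPath (join k₂ (path W₂) (adj′ xp₂) (join β (path (end x)) xp₁ (join α (rev (path W₁)) wz₂ (path W₃))))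
            (↭-trans (Bag.solve 11 (λ x y a b k₁ z k′ k₂ as bs cs →
               z Bag.⊕ (y Bag.⊕ (k₁ Bag.⊕ (k′ Bag.⊕ (k₂ Bag.⊕ (bs Bag.⊕ (b Bag.⊕ (x Bag.⊕ (a Bag.⊕ (as Bag.⊕ cs)))))))))
                 Bag.⊜ x Bag.⊕ (y Bag.⊕ (a Bag.⊕ (b Bag.⊕ (as Bag.⊕ (k₁ Bag.⊕ (z Bag.⊕ (k′ Bag.⊕ (bs Bag.⊕ (k₂ Bag.⊕ cs))))))))))
               ↭-refl [ ι x ] [ ι y ] [ κ α ] [ κ β ] [ κ k₁ ] [ ι z₁ ] [ κ k′ ] [ κ k₂ ] as bs cs)
              (↭-trans (prep _ (prep _ (prep _ (prep _ (↭-sym items-↭))))) perm))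
            syz (Eq.trans (adj-side k′ z₁ r l′) (sym syz)) (Eq.trans side-t (Eq.trans (not-flip side-y) (sym (heavy-side heavy))))) heavy
        where
        syz : side y ≡ not (side z₁)
        syz = not-flip (heavy-side heavy)

      after : ∀ {e₁ e₂} → e₁ ∈ edges W → (s : Split W e₁) → e₂ ∈ edges (Split.W₂ s) →
        Heavy (head e₁) y → Heavy (head e₂) y → Bad e₁ → Bad e₂ → Win
      -- Two vertices heavy with `y` lie on the same side and cannot be consecutive, so a vertex `r`
      -- lies between them.
      after _ (mkSplit W₁ l (step _ k′ l′ W₂) refl _) (here refl) h₁ h₂ _ _ =
        ⊥-elim (true≢false l′ (same-side (Eq.trans (heavy-side h₁) (sym (heavy-side h₂)))))
      after {e₁} {e₂} _ (mkSplit {as} W₁ l (step _ k′ l′ W₂) refl _) (there e₂∈) h₁ _ b₁ b₂ with split W₂ e₂∈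
      ... | mkSplit {bs} {cs} V₁ _ V₂ refl _ = two-bad {e₁} {e₂} W₁ l′ V₁ V₂ ↭-refl h₁ b₁ b₂

      both : ∀ {e₁ e₂} → e₁ ∈ edges W → e₂ ∈ edges W → (head e₁ ≡ head e₂ → ⊥) → Heavy (head e₁) y → Heavy (head e₂) y →
        Bad e₁ → Bad e₂ → Win
      both {e₁} {e₂} e₁∈ e₂∈ ne h₁ h₂ b₁ b₂ with split W e₁∈
      ... | s@(mkSplit {as} {bs} W₁ l₁ W₂ items-≡ edges-≡) with ∈-++⁻ (edges W₁) (subst (e₂ ∈_) edges-≡ e₂∈)
      ...   | inj₂ (here refl)  = ⊥-elim (ne refl)
      ...   | inj₂ (there i)    = after e₁∈ s i h₁ h₂ b₁ b₂
      ...   | inj₁ i with split W₁ i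
      ...     | mkSplit {cs} V₁ l₂ (end _) refl _ =
                  ⊥-elim (true≢false l₁ (same-side (Eq.trans (heavy-side h₂) (sym (heavy-side h₁)))))
      ...     | mkSplit {cs} V₁ l₂ (step _ k′ {xs = ds} l′ V₂) refl _ = two-bad {e₂} {e₁} V₁ l′ V₂ W₂
                  (subst (_↭ _) (sym items-≡) (↭-reflexive (++-assoc cs (κ (colour e₂) ∷ ι (head e₂) ∷ κ k′ ∷ ds) (κ (colour e₁) ∷ bs)))) h₂ b₂ b₁

    win-long : ∀ {x y t c xs} → Walk x t xs → ι y ∷ κ c ∷ xs ↭ Stock → side y ≡ not (side x) → side t ≡ side x → Win
    win-long {x} {y} (end _) perm sy st = ⊥-elim (1+n≰n (≤-trans (s≤s (s≤s z≤n)) (≤-trans 3≤n (≤-reflexive one))))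
      where one : n ≡ 1
            one = Eq.trans (sym (side-size (side x))) (Eq.trans (sym (count-↭ (onV (eqᵇ (side x) ∘ side)) perm))
              (cong₂ (λ a b → # a + (# b + 0)) (eqᵇ-≡not sy) (eqᵇ-refl (side x))))
    win-long {x} {y} {t} {c} (step _ k {w} {xs = xs} a W) perm sy st with classify q
      where q : AvoidingPath x y w t c k
            q = mkPath W (↭-trans (Bag.solve 5 (λ x y c k xs → x Bag.⊕ (y Bag.⊕ (c Bag.⊕ (k Bag.⊕ xs))) Bag.⊜ y Bag.⊕ (c Bag.⊕ (x Bag.⊕ (k Bag.⊕ xs))))
                  ↭-refl [ ι x ] [ ι y ] [ κ c ] [ κ k ] xs) perm) sy (Eq.trans (adj-side k x w a) (sym sy)) st
    ... | inj₁ v                   = v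
    ... | inj₂ (inj₁ (_ , b))      = win-cycle b
    ... | inj₂ (inj₂ (inj₂ tied))  = ⊥-elim (true≢false (adj′ a) (Tied′.x-β tied))
    ... | inj₂ (inj₂ (inj₁ tied))  with two-heavy y
    ...   | z₁ , z₂ , rest , p , h₁ , h₂ = place h₁ (there-edge h₁ (here refl)) h₂ (there-edge h₂ (there (here refl)))
      where
      q : AvoidingPath x y w t c k
      q = mkPath W (↭-trans (Bag.solve 5 (λ x y c k xs → x Bag.⊕ (y Bag.⊕ (c Bag.⊕ (k Bag.⊕ xs))) Bag.⊜ y Bag.⊕ (c Bag.⊕ (x Bag.⊕ (k Bag.⊕ xs))))
            ↭-refl [ ι x ] [ ι y ] [ κ c ] [ κ k ] xs) perm) sy (Eq.trans (adj-side k x w a) (sym sy)) st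
      there-edge : ∀ {z} → Heavy z y → ι z ∈ ι z₁ ∷ ι z₂ ∷ rest → Win ⊎ ∃ λ e → e ∈ edges W × head e ≡ z
      there-edge {z} h z∈ with ∈-resp-↭ (↭-sym (AvoidingPath.perm q)) (∈-resp-↭ (↭-sym p) z∈)
      ... | here refl                          = inj₁ (win-heavy-path 2≤h q h)
      ... | there (here refl)                  = ⊥-elim (1+n≰n (≤-trans (s≤s (s≤s z≤n)) (≤-trans 3≤n (≤-trans h (s≤s (≤-reflexive (count-zero (λ { (ι _) → refl ; (κ _) → no-loop }) Stock)))))))
      ... | there (there (there (there i))) with head-edge W i
      ...   | inj₁ refl = ⊥-elim (true≢false (eqᵇ-≡ (sym (adj-side k x w a))) (eqᵇ-≡not (Eq.trans (heavy-side h) (cong not sy))))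
      ...   | inj₂ found = inj₂ found
      place : Heavy z₁ y → Win ⊎ (∃ λ e → e ∈ edges W × head e ≡ z₁) → Heavy z₂ y → Win ⊎ (∃ λ e → e ∈ edges W × head e ≡ z₂) → Win
      place _ (inj₁ v) _ _ = v
      place _ (inj₂ _) _ (inj₁ v) = v
      place h₁ (inj₂ (e₁ , i₁ , refl)) h₂ (inj₂ (e₂ , i₂ , refl)) with good-or-bad q tied i₁ h₁ | good-or-bad q tied i₂ h₂
      ... | inj₁ v  | _       = v
      ... | inj₂ _  | inj₁ v  = v
      ... | inj₂ b₁ | inj₂ b₂ = both q tied i₁ i₂ (λ eq → distinct (subst (λ z → Stock ↭ ι z ∷ ι z₂ ∷ rest) eq p)) h₁ h₂ b₁ b₂

  ιs : List V → List Item
  ιs = map ι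

  κs : List C → List Item
  κs = map κ

  count-ιs : ∀ f os → count (onV f) (ιs os) ≡ count f os
  count-ιs f []       = refl
  count-ιs f (o ∷ os) = cong (# (f o) +_) (count-ιs f os)

  count-κs : ∀ f (fs : List C) → count (onV f) (κs fs) ≡ 0
  count-κs f []       = refl
  count-κs f (_ ∷ fs) = count-κs f fs

  count-parts : ∀ f xs os fs → count (onV f) (xs ++ ιs os ++ κs fs) ≡ count (onV f) xs + count f os
  count-parts f xs os fs = Eq.trans (count-++ (onV f) xs _) (cong (count (onV f) xs +_)
    (Eq.trans (count-++ (onV f) (ιs os) _) (Eq.trans (cong₂ _+_ (count-ιs f os) (count-κs f fs)) (+-identityʳ _))))

  pick : ∀ {A : Set} (f : A → Bool) xs → (∃ λ x → ∃ λ ys → xs ↭ x ∷ ys × f x ≡ true) ⊎ count f xs ≡ 0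
  pick f xs with count f xs in eq
  ... | zero  = inj₂ refl
  ... | suc m with count-pos f xs (subst (1 ≤_) (sym eq) (s≤s z≤n))
  ...   | x , x∈ , fx = inj₁ (x , proj₁ (extract x∈) , proj₂ (extract x∈) , fx)

  pick! : ∀ {A : Set} (f : A → Bool) xs → 1 ≤ count f xs → ∃ λ x → ∃ λ ys → xs ↭ x ∷ ys × f x ≡ true
  pick! f xs p with count-pos f xs p
  ... | x , x∈ , fx = x , proj₁ (extract x∈) , proj₂ (extract x∈) , fx

  stop∈ : ∀ {u v xs} → Walk u v xs → ι v ∈ xs
  stop∈ (end v)        = here refl
  stop∈ (step u k a W) = there (there (stop∈ W))

  colour-edge : ∀ {u v xs d} (W : Walk u v xs) → κ d ∈ xs → ∃ λ e → e ∈ edges W × colour e ≡ d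
  colour-edge (end v)        (there ())
  colour-edge (step u k a W) (there (here refl))  = _ , here refl , refl
  colour-edge (step u k a W) (there (there d∈))   = let e , e∈ , eq = colour-edge W d∈ in e , there e∈ , eq

  private
    swap-sides : ∀ {u v xs} (W : Walk u v xs) s →
      count (onSide s) (edges W) ≡ count (eqᵇ (not s) ∘ side ∘ tail) (edges W)
    swap-sides W s = ≤-antisym
      (count-mono (edges W) (λ e∈ eq → eqᵇ-≡ (sym (Eq.trans (not-flip (adj-side _ _ _ (edge-adj W e∈))) (cong not (sym (eqᵇ⇒≡ eq)))))))
      (count-mono (edges W) (λ e∈ eq → eqᵇ-≡ (sym (Eq.trans (adj-side _ _ _ (edge-adj W e∈)) (Eq.trans (cong not (sym (eqᵇ⇒≡ eq))) (not-involutive s))))))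

  balance : ∀ {u v xs} (W : Walk u v xs) s →
    count (onV (eqᵇ s ∘ side)) xs + # (eqᵇ (not s) (side v)) ≡ # (eqᵇ s (side u)) + count (onV (eqᵇ (not s) ∘ side)) xs
  balance {u} {v} W s rewrite count-heads (eqᵇ s ∘ side) W | count-tails (eqᵇ (not s) ∘ side) W | swap-sides W s =
    +-assoc (# (eqᵇ s (side u))) _ _

  -- The path alternates sides greedily. The two inequalities say that the side opposite to `o` has
  -- as many unvisited vertices as that of `o`, or one more; stepping to the other side exchanges
  -- them. One colour per unvisited vertex makes the path use all of `cs`.
  complete-path : ∀ m o rs cs → length rs ≡ m → length cs ≡ m →
    (∀ {c p q} → c ∈ cs → p ∈ o ∷ rs → q ∈ o ∷ rs → side q ≡ not (side p) → adj c p q ≡ true) →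
    count (eqᵇ (side o) ∘ side) rs ≤ count (eqᵇ (not (side o)) ∘ side) rs →
    count (eqᵇ (not (side o)) ∘ side) rs ≤ suc (count (eqᵇ (side o) ∘ side) rs) →
    ∃ λ e → Path o e (ι o ∷ ιs rs ++ κs cs)
  complete-path zero    o []       []       _ _ _ _ _ = o , path (end o)
  complete-path (suc m) o rs@(r₀ ∷ _) (c ∷ cs) lr lc adj-c le₁ le₂
    with pick! (eqᵇ (not (side o)) ∘ side) rs positive
    where
    positive : 1 ≤ count (eqᵇ (not (side o)) ∘ side) rs
    positive = go (eqᵇ (side o) (side r₀)) refl
      where
      other : ∀ {a b} → eqᵇ a b ≡ false → eqᵇ (not a) b ≡ true
      other {true}  {false} _ = refl
      other {false} {true}  _ = refl
      go : ∀ b → eqᵇ (side o) (side r₀) ≡ b → 1 ≤ count (eqᵇ (not (side o)) ∘ side) rs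
      go true  eq = ≤-trans (count-∈ (eqᵇ (side o) ∘ side) {xs = rs} (here refl) eq) le₁
      go false eq = count-∈ (eqᵇ (not (side o)) ∘ side) {xs = rs} (here refl) (other {side o} {side r₀} eq)
  ... | r , rs′ , p , sr with complete-path m r rs′ cs (suc-injective (Eq.trans (sym (↭-length p)) lr)) (suc-injective lc)
        (λ c∈ p∈ q∈ → adj-c (there c∈) (there (∈-resp-↭ (↭-sym p) p∈)) (there (∈-resp-↭ (↭-sym p) q∈))) bal₁ bal₂
    where
    r-side : side r ≡ not (side o)
    r-side = sym (eqᵇ⇒≡ sr)
    opp : count (eqᵇ (not (side o)) ∘ side) rs ≡ suc (count (eqᵇ (side r) ∘ side) rs′)
    opp = Eq.trans (count-↭ (eqᵇ (not (side o)) ∘ side) p) (cong₂ (λ b s → # b + count (eqᵇ s ∘ side) rs′) sr (sym r-side))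
    same : count (eqᵇ (side o) ∘ side) rs ≡ count (eqᵇ (not (side r)) ∘ side) rs′
    same = Eq.trans (count-↭ (eqᵇ (side o) ∘ side) p) (cong₂ (λ b s → # b + count (eqᵇ s ∘ side) rs′) (eqᵇ-≡not r-side) (not-flip r-side))
    bal₁ : count (eqᵇ (side r) ∘ side) rs′ ≤ count (eqᵇ (not (side r)) ∘ side) rs′
    bal₁ = s≤s⁻¹ (subst₂ (λ i j → i ≤ suc j) opp same le₂)
    bal₂ : count (eqᵇ (not (side r)) ∘ side) rs′ ≤ suc (count (eqᵇ (side r) ∘ side) rs′)
    bal₂ = subst₂ _≤_ same opp le₁
  ... | e , P = e , repath (join c (path (end o)) (adj-c (here refl) (here refl) (there (∈-resp-↭ (↭-sym p) (here refl))) (sym (eqᵇ⇒≡ sr))) P)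
    (↭-trans (Bag.solve 5 (λ c o r rs cs → c Bag.⊕ (o Bag.⊕ (r Bag.⊕ (rs Bag.⊕ cs))) Bag.⊜ o Bag.⊕ ((r Bag.⊕ rs) Bag.⊕ (c Bag.⊕ cs))) ↭-refl
       [ κ c ] [ ι o ] [ ι r ] (ιs rs′) (κs cs))
      (prep _ (++⁺ʳ (κ c ∷ κs cs) (map⁺ ι (↭-sym p)))))

  rotate : ∀ {a b d xs z} → Walk a b xs → adj d b a ≡ true → ι z ∈ xs →
    ∃ λ b′ → ∃ λ d′ → ∃ λ xs′ → Walk z b′ xs′ × κ d′ ∷ xs′ ↭ κ d ∷ xs
  rotate {b = b} {d} {xs} W cl z∈ with head-edge W z∈
  ... | inj₁ refl            = b , d , xs , W , ↭-refl
  ... | inj₂ (e , e∈ , refl) with split W e∈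
  ...   | mkSplit {as} {bs} W₁ l W₂ refl _ = _ , colour e , _ , joinW d W₂ cl W₁ ,
    Bag.solve 4 (λ k d as bs → k Bag.⊕ (bs Bag.⊕ (d Bag.⊕ as)) Bag.⊜ d Bag.⊕ (as Bag.⊕ (k Bag.⊕ bs))) ↭-refl [ κ (colour e) ] [ κ d ] as bs

  none : ∀ {A : Set} {f : A → Bool} xs → (∀ {x} → x ∈ xs → f x ≡ false) → count f xs ≡ 0
  none []       h = refl
  none (x ∷ xs) h rewrite h (here refl) = none xs (h ∘ there)

  opposite : ∀ c v {i : Item} → onV (adj c v) i ≡ true → onV (eqᵇ (not (side v)) ∘ side) i ≡ true
  opposite c v {ι q} a = eqᵇ-≡ (sym (adj-side c v q a))
  opposite c v {κ _} ()

  -- The colours inside are just those that the cycle happens to use; `no-cross` is about all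
  -- colours. Completeness of both parts is not stored, as it follows from the degrees.
  record Extremal : Set where
    constructor mkExtremal
    field
      inside   : List Item
      outside  : List V
      rest     : List C
      perm     : inside ++ ιs outside ++ κs rest ↭ Stock
      n≡2h     : n ≡ h + h
      half-in  : ∀ s → count (onV (eqᵇ s ∘ side)) inside ≡ h
      half-out : ∀ s → count (eqᵇ s ∘ side) outside ≡ h
      no-cross : ∀ d {z o} → ι z ∈ inside → o ∈ outside → adj d z o ≡ false

  module _ {xs os fs} (perm : xs ++ ιs os ++ κs fs ↭ Stock) where

    sizes : ∀ f → count (onV f) Stock ≡ count (onV f) xs + count f os
    sizes f = Eq.trans (sym (count-↭ (onV f) perm)) (count-parts f xs os fs)

    -- All of the at least h neighbours of `z` are among the at most h opposite vertices inside, so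
    -- none of these is missed.
    complete-in : ∀ {d z z′} → count (onV (eqᵇ (not (side z)) ∘ side)) xs ≤ h → (∀ {o} → o ∈ os → adj d z o ≡ false) →
      ι z′ ∈ xs → side z′ ≡ not (side z) → adj d z z′ ≡ true
    complete-in {d} {z} {z′} half apart z∈ s with adj d z z′ in a
    ... | true  = refl
    ... | false = ⊥-elim (1+n≰n (≤-trans (count-strict xs (λ {i} → opposite d z {i}) z∈ a (eqᵇ-≡ (sym s)))
          (≤-trans half (≤-trans (degree d z) (≤-reflexive (Eq.trans (sizes (adj d z))
            (Eq.trans (cong (count (onV (adj d z)) xs +_) (none os apart)) (+-identityʳ _))))))))

    complete-out : ∀ {d o o′} → count (eqᵇ (not (side o)) ∘ side) os ≤ h → (∀ {z} → ι z ∈ xs → adj d z o ≡ false) →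
      o′ ∈ os → side o′ ≡ not (side o) → adj d o o′ ≡ true
    complete-out {d} {o} {o′} half apart o∈ s with adj d o o′ in a
    ... | true  = refl
    ... | false = ⊥-elim (1+n≰n (≤-trans (count-strict os (λ {q} e → eqᵇ-≡ (sym (adj-side d o q e))) o∈ a (eqᵇ-≡ (sym s)))
          (≤-trans half (≤-trans (degree d o) (≤-reflexive (Eq.trans (sizes (adj d o))
            (cong (_+ count (adj d o) os) (none xs λ { {ι z} z∈ → Eq.trans (adj-sym d o z) (apart z∈) ; {κ _} _ → refl }))))))))

  -- The colours in m ∷ ms join nothing inside to anything outside, so they are complete on both parts;
  -- a single edge crossing in another colour d then completes the cycle inside to a Hamiltonian path.
  module _ {a b c xs os m ms} (W : Walk a b xs) (cl : adj c b a ≡ true)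
    (perm : (κ c ∷ xs) ++ ιs os ++ κs (m ∷ ms) ↭ Stock)
    (lengths : length os ≡ suc (suc (length ms))) (n≡ : n ≡ h + h)
    (half-in : ∀ s → count (onV (eqᵇ s ∘ side)) xs ≡ h) (half-out : ∀ s → count (eqᵇ s ∘ side) os ≡ h)
    (no-free : ∀ {f} → f ∈ m ∷ ms → ∀ {z o} → ι z ∈ xs → o ∈ os → adj f z o ≡ false) where

    private
      not-c : ∀ {z} → ι z ∈ κ c ∷ xs → ι z ∈ xs
      not-c (there i) = i

    free-in : ∀ {f z z′} → f ∈ m ∷ ms → ι z ∈ xs → ι z′ ∈ xs → side z′ ≡ not (side z) → adj f z z′ ≡ true
    free-in {z = z} f∈ z∈ z′∈ = complete-in perm (≤-reflexive (half-in (not (side z)))) (no-free f∈ z∈) (there z′∈)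

    free-out : ∀ {f o o′} → f ∈ m ∷ ms → o ∈ os → o′ ∈ os → side o′ ≡ not (side o) → adj f o o′ ≡ true
    free-out {o = o} f∈ o∈ = complete-out perm (≤-reflexive (half-out (not (side o)))) (λ z∈ → no-free f∈ (not-c z∈) o∈)

    win-crossing : ∀ {d z o} → κ d ∈ κ c ∷ xs → ι z ∈ xs → o ∈ os → adj d z o ≡ true → Win
    win-crossing {d} {z} {o} d∈ z∈ o∈ zo with rotate W cl z∈ | extract o∈
    ... | b′ , c′ , xs′ , W′ , p | os₁ , r = decide (adj c′ z o) refl
      where
      sub : ∀ {q} → q ∈ o ∷ os₁ → q ∈ os
      sub = ∈-resp-↭ (↭-sym r)
      sub-in : ∀ {q} → ι q ∈ xs′ → ι q ∈ xs
      sub-in q∈ = not-c (∈-resp-↭ p (there q∈))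
      out-count : ∀ s → # (eqᵇ s (side o)) + count (eqᵇ s ∘ side) os₁ ≡ h
      out-count s = Eq.trans (sym (count-↭ (eqᵇ s ∘ side) r)) (half-out s)
      opp : count (eqᵇ (not (side o)) ∘ side) os₁ ≡ h
      opp = Eq.trans (cong (λ b → # b + count (eqᵇ (not (side o)) ∘ side) os₁) (sym (eqᵇ-≡not (sym (not-involutive (side o)))))) (out-count (not (side o)))
      same : suc (count (eqᵇ (side o) ∘ side) os₁) ≡ h
      same = Eq.trans (cong (λ b → # b + count (eqᵇ (side o) ∘ side) os₁) (sym (eqᵇ-refl (side o)))) (out-count (side o))
      total : κ c′ ∷ xs′ ++ ιs (o ∷ os₁) ++ κs (m ∷ ms) ↭ Stock
      total = ↭-trans (++⁺ p (++⁺ʳ (κs (m ∷ ms)) (map⁺ ι (↭-sym r)))) perm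
      decide : ∀ i → adj c′ z o ≡ i → Win
      -- If the closing colour of the cycle opened at `z` joins `z` to `o`, it links the opened
      -- cycle to a path through the outside.
      decide true zo′ with complete-path _ o os₁ (m ∷ ms) refl (suc-injective (Eq.trans (sym lengths) (↭-length r)))
          (λ f∈ p∈ q∈ → free-out f∈ (sub p∈) (sub q∈))
          (≤-trans (n≤1+n _) (≤-reflexive (Eq.trans same (sym opp)))) (≤-reflexive (Eq.trans opp (sym same)))
      ... | e , P = win (join c′ (rev P) (adj′ zo′) (path W′))
        (↭-trans (Bag.solve 5 (λ c xs o os fs → c Bag.⊕ ((o Bag.⊕ (os Bag.⊕ fs)) Bag.⊕ xs) Bag.⊜ c Bag.⊕ (xs Bag.⊕ (o Bag.⊕ (os Bag.⊕ fs)))) ↭-refl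
          [ κ c′ ] xs′ [ ι o ] (ιs os₁) (κs (m ∷ ms))) total)
      -- Now `d` is the colour of an edge of the opened cycle. That edge is recoloured with the
      -- spare `m`, which frees `d` for `z o`. As `o` misses `z` in `c′`, it has at most h - 1 such
      -- neighbours inside, hence one outside on which `c′` can be spent.
      decide false zo′ with ∈-resp-↭ (↭-sym p) d∈
      ... | here refl  = ⊥-elim (true≢false zo zo′)
      ... | there d∈′ with colour-edge W′ d∈′ | pick! (adj c′ o) os₁ neighbour
        where
        so : side o ≡ not (side z)
        so = adj-side d z o zo
        neighbour : 1 ≤ count (adj c′ o) os₁
        neighbour = +-cancelˡ-≤ (count (onV (adj c′ o)) (κ c ∷ xs)) _ _ (≤-trans (≤-reflexive (+-comm (count (onV (adj c′ o)) xs) 1))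
          (≤-trans (count-strict xs (λ {i} → opposite c′ o {i}) z∈ (Eq.trans (adj-sym c′ o z) zo′) (eqᵇ-≡ (sym (not-flip so))))
          (≤-trans (≤-reflexive (half-in (not (side o)))) (≤-trans (degree c′ o) (≤-reflexive (Eq.trans (sizes {κ c ∷ xs} {os} {m ∷ ms} perm (adj c′ o))
            (cong (count (onV (adj c′ o)) xs +_) (Eq.trans (count-↭ (adj c′ o) r) (cong (λ b → # b + count (adj c′ o) os₁) (no-loop {c′} {o})))))))))) 
      ...   | e@(p₀ , _ , q₀) , e∈ , refl | o′ , os₂ , r′ , oo′ with split W′ e∈
      ...     | mkSplit {as} {bs} W₁ l W₂ refl _ with complete-path _ o′ os₂ ms refl
                  (suc-injective (suc-injective (Eq.trans (sym lengths) (Eq.trans (↭-length r) (cong suc (↭-length r′))))))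
                  (λ f∈ p∈ q∈ → free-out (there f∈) (sub (there (∈-resp-↭ (↭-sym r′) p∈))) (sub (there (∈-resp-↭ (↭-sym r′) q∈))))
                  (≤-reflexive (Eq.trans same′ (sym opp′))) (≤-trans (≤-reflexive (Eq.trans opp′ (sym same′))) (n≤1+n _))
        where
        so′ : side o′ ≡ not (side o)
        so′ = adj-side c′ o o′ oo′
        k = count (eqᵇ (side o) ∘ side) os₁
        same′ : count (eqᵇ (side o′) ∘ side) os₂ ≡ k
        same′ = suc-injective (Eq.trans (Eq.trans (cong (λ b → # b + count (eqᵇ (side o′) ∘ side) os₂) (sym (eqᵇ-refl (side o′))))
          (sym (count-↭ (eqᵇ (side o′) ∘ side) r′))) (Eq.trans (cong (λ s → count (eqᵇ s ∘ side) os₁) so′) (Eq.trans opp (sym same))))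
        opp′ : count (eqᵇ (not (side o′)) ∘ side) os₂ ≡ k
        opp′ = Eq.trans (Eq.trans (cong (λ b → # b + count (eqᵇ (not (side o′)) ∘ side) os₂) (sym (eqᵇ-≡not (sym (not-involutive (side o′))))))
          (sym (count-↭ (eqᵇ (not (side o′)) ∘ side) r′))) (cong (λ s → count (eqᵇ s ∘ side) os₁) (sym (not-flip so′)))
      ...       | e′ , P = win (join d (join c′ (rev P) (adj′ oo′) (path (end o))) (adj′ zo)
                    (join m (path W₁) (free-in (here refl) (sub-in (∈-++⁺ˡ (stop∈ W₁))) (sub-in (∈-++⁺ʳ as (there (start∈ W₂)))) (adj-side _ _ _ l)) (path W₂)))
        (↭-trans (Bag.solve 9 (λ d c o o′ os ms m as bs →
            d Bag.⊕ ((c Bag.⊕ ((o′ Bag.⊕ (os Bag.⊕ ms)) Bag.⊕ o)) Bag.⊕ (m Bag.⊕ (as Bag.⊕ bs)))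
            Bag.⊜ c Bag.⊕ ((as Bag.⊕ (d Bag.⊕ bs)) Bag.⊕ ((o Bag.⊕ (o′ Bag.⊕ os)) Bag.⊕ (m Bag.⊕ ms)))) ↭-refl
            [ κ d ] [ κ c′ ] [ ι o ] [ ι o′ ] (ιs os₂) (κs ms) [ κ m ] as bs)
          (↭-trans (prep _ (++⁺ˡ (as ++ κ d ∷ bs) (++⁺ʳ (κs (m ∷ ms)) (prep _ (map⁺ ι (↭-sym r′)))))) total))

  -- Inserting the last vertex.

  -- A neighbour of `y` in the last colour is an end of the path or strictly inside it; in the
  -- latter case `x`, `z`, `t` are three vertices on one side, which needs n ≥ 3.
  win-short : ∀ {x y t c xs} → ¬ (3 ≤ n) → Walk x t xs → ι y ∷ κ c ∷ xs ↭ Stock → side y ≡ not (side x) → side t ≡ side x → Win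
  win-short {x} {y} {t} {c} {xs} n≱3 W perm sy st with count-pos (onV (adj c y)) xs
      (≤-trans (h≥1 h n≤2h) (≤-trans (degree c y) (≤-reflexive (Eq.trans (sym (count-↭ (onV (adj c y)) perm))
        (cong (λ b → # b + count (onV (adj c y)) xs) (no-loop {c} {y}))))))
    where h≥1 : ∀ h → n ≤ h + h → 1 ≤ h
          h≥1 zero    le = ≤-trans 1≤n le
          h≥1 (suc _) _  = s≤s z≤n
  ... | ι z , z∈ , yz with head-edge W z∈
  ...   | inj₁ refl = win (join c (path (end y)) yz (path W)) (↭-trans (swap _ _ ↭-refl) perm)
  ...   | inj₂ (e , e∈ , refl) with split W e∈
  ...     | mkSplit W₁ l (end _) refl _ = win (join c (path (end y)) yz (rev (path W))) (↭-trans (swap _ _ ↭-refl) perm)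
  ...     | mkSplit {as} W₁ l (step _ k {xs = bs} _ W₂) refl _ = ⊥-elim (n≱3 (≤-trans three (≤-reflexive size)))
    where
    f : Item → Bool
    f = onV (eqᵇ (side x) ∘ side)
    sz : side z ≡ side x
    sz = Eq.trans (adj-side c y z yz) (sym (not-flip sy))
    three : 3 ≤ count f as + (1 + count f bs)
    three = +-mono-≤ (count-∈ f (start∈ W₁) (eqᵇ-refl (side x))) (+-monoʳ-≤ 1 (count-∈ f (stop∈ W₂) (eqᵇ-≡ (sym st))))
    size : count f as + (1 + count f bs) ≡ n
    size = Eq.trans (Eq.trans (cong (λ b → count f as + (# b + count f bs)) (sym (eqᵇ-≡ (sym sz)))) (sym (count-++ f as _)))
      (Eq.trans (Eq.trans (cong (λ b → # b + count f xs) (sym (eqᵇ-≡not sy))) (count-↭ f perm)) (side-size (side x)))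

  win-last : ∀ {x y t c xs} → Walk x t xs → ι y ∷ κ c ∷ xs ↭ Stock → side y ≡ not (side x) → side t ≡ side x → Win
  win-last W perm sy st with 3 ≤? n
  ... | yes 3≤n = win-long (2≤h h n≤2h) 3≤n W perm sy st
    where 2≤h : ∀ h → n ≤ h + h → 2 ≤ h
          2≤h zero          le = ⊥-elim (1+n≰n (≤-trans (≤-trans (s≤s z≤n) 3≤n) le))
          2≤h (suc zero)    le = ⊥-elim (1+n≰n (≤-trans 3≤n le))
          2≤h (suc (suc _)) _  = s≤s (s≤s z≤n)
  ... | no  n≱3 = win-short n≱3 W perm sy st

  vanish : ∀ {A : Set} {f : A → Bool} {xs} → count f xs ≡ 0 → ∀ {x} → x ∈ xs → f x ≡ false
  vanish {f = f} eq {x} x∈ with f x in fx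
  ... | false = refl
  ... | true  = ⊥-elim (1+n≰n (subst (1 ≤_) eq (count-∈ f x∈ fx)))

  scan : ∀ (is xs : List Item) (os : List V) →
    (∃ λ f → ∃ λ z → ∃ λ o → κ f ∈ is × ι z ∈ xs × o ∈ os × adj f z o ≡ true) ⊎
    (∀ {f} → κ f ∈ is → ∀ {z o} → ι z ∈ xs → o ∈ os → adj f z o ≡ false)
  scan is xs os = sequence {P = λ i → ∀ {f} → i ≡ κ f → ∀ {z o} → ι z ∈ xs → o ∈ os → adj f z o ≡ false} is at-colour ⟫ λ h i → h i refl
    where
    Found = ∃ λ f → ∃ λ z → ∃ λ o → κ f ∈ is × ι z ∈ xs × o ∈ os × adj f z o ≡ true
    _⟫_ : ∀ {A A′ : Set} → Found ⊎ A → (A → A′) → Found ⊎ A′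
    inj₁ x ⟫ _ = inj₁ x
    inj₂ y ⟫ g = inj₂ (g y)
    at-colour : ∀ {i} → i ∈ is → Found ⊎ (∀ {f} → i ≡ κ f → ∀ {z o} → ι z ∈ xs → o ∈ os → adj f z o ≡ false)
    at-colour {ι _} _  = inj₂ λ ()
    at-colour {κ f} f∈ = sequence {P = λ i → ∀ {z} → i ≡ ι z → ∀ {o} → o ∈ os → adj f z o ≡ false} xs at-vertex
        ⟫ λ { h refl z∈ o∈ → h z∈ refl o∈ }
      where
      at-vertex : ∀ {i} → i ∈ xs → Found ⊎ (∀ {z} → i ≡ ι z → ∀ {o} → o ∈ os → adj f z o ≡ false)
      at-vertex {κ _} _  = inj₂ λ ()
      at-vertex {ι z} z∈ with pick (adj f z) os
      ... | inj₁ (o , _ , p , a) = inj₁ (f , z , o , f∈ , z∈ , ∈-resp-↭ (↭-sym p) (here refl) , a)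
      ... | inj₂ eq              = inj₂ λ { refl → vanish eq }

  which-side : ∀ s v → side v ≡ s ⊎ side v ≡ not s
  which-side s v with s | side v
  ... | true  | true  = inj₁ refl
  ... | true  | false = inj₂ refl
  ... | false | true  = inj₂ refl
  ... | false | false = inj₁ refl

  -- Growing a rainbow path until one vertex is missing.

  Buildable : ℕ → Set
  Buildable k = ∀ {u v xs} os fs → length os ≡ k → length fs ≡ k → Walk u v xs → xs ++ ιs os ++ κs fs ↭ Stock → Win ⊎ Extremal

  -- Either the ends can be linked to new vertices, or they cross on the path, which then closes up to a cycle.
  grow : ∀ k → Buildable (suc k) → Buildable (suc (suc k))
  grow k ih {u} {v} {xs} os (a ∷ b ∷ fs) lo lf W perm = ends (pick (adj a u) os) (which-side σ v)
    where
    σ = side u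
    X Y X′ Y′ : ℕ
    X  = count (onV (eqᵇ σ ∘ side)) xs
    Y  = count (onV (eqᵇ (not σ) ∘ side)) xs
    X′ = count (eqᵇ σ ∘ side) os
    Y′ = count (eqᵇ (not σ) ∘ side) os
    sizes′ : ∀ f → count (onV f) Stock ≡ count (onV f) xs + count f os
    sizes′ = sizes {xs} {os} {a ∷ b ∷ fs} perm
    sizeX : n ≡ X + X′
    sizeX = Eq.trans (sym (side-size σ)) (sizes′ (eqᵇ σ ∘ side))
    sizeY : n ≡ Y + Y′
    sizeY = Eq.trans (sym (side-size (not σ))) (sizes′ (eqᵇ (not σ) ∘ side))
    bal : X + # (eqᵇ (not σ) (side v)) ≡ suc Y
    bal = Eq.trans (balance W σ) (cong (λ b → # b + Y) (eqᵇ-refl σ))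

    onward : ∀ {u v xs} os fs → Path u v xs → length os ≡ suc k → length fs ≡ suc k → xs ++ ιs os ++ κs fs ↭ Stock → Win ⊎ Extremal
    onward os fs (_ , W , p) lo lf q = ih os fs lo lf W (↭-trans (++⁺ʳ (ιs os ++ κs fs) p) q)

    shorter : ∀ {o os′} → os ↭ o ∷ os′ → length os′ ≡ suc k
    shorter p = suc-injective (Eq.trans (sym (↭-length p)) lo)

    within : ∀ {o os′ as} → os ↭ o ∷ os′ → as ↭ xs ++ (ιs (o ∷ os′)) ++ κs (a ∷ b ∷ fs) → as ↭ Stock
    within p q = ↭-trans q (↭-trans (++⁺ˡ xs (++⁺ʳ (κs (a ∷ b ∷ fs)) (map⁺ ι (↭-sym p)))) perm)

    -- A cycle costs one more colour, so k + 2 vertices but only k + 1 colours remain outside. An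
    -- edge leaving the cycle in a remaining colour opens it to a longer path. Otherwise the colour
    -- `f` keeps the h neighbours of every vertex within its own part, which forces both parts to
    -- have exactly h vertices on each side.
    close-up : ∀ {a b d xs f fs} → Walk a b xs → adj d b a ≡ true → (κ d ∷ xs) ++ ιs os ++ κs (f ∷ fs) ↭ Stock → length fs ≡ k →
      side b ≡ not (side a) → Win ⊎ Extremal
    close-up {a} {b} {d} {xs} {f} {fs} W cl perm lf sb with scan (κs (f ∷ fs)) xs os
    ... | inj₁ (g , z , o , g∈ , z∈ , o∈ , zo) with ∈-map⁻ κ g∈
    ...   | _ , g∈′ , refl with extract g∈′ | extract o∈ | rotate W cl z∈
    ...     | fs′ , r | os′ , p | b′ , d′ , xs′ , W′ , s = onward os′ (d′ ∷ fs′) (join g (path (end o)) (adj′ zo) (path W′)) (shorter p)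
        (Eq.trans (sym (↭-length r)) (cong suc lf))
        (↭-trans (Bag.solve 6 (λ g o xs os d fs → (g Bag.⊕ (o Bag.⊕ xs)) Bag.⊕ (os Bag.⊕ (d Bag.⊕ fs)) Bag.⊜ (d Bag.⊕ xs) Bag.⊕ ((o Bag.⊕ os) Bag.⊕ (g Bag.⊕ fs))) ↭-refl
            [ κ g ] [ ι o ] xs′ (ιs os′) [ κ d′ ] (κs fs′))
          (↭-trans (++⁺ s (++⁺ (map⁺ ι (↭-sym p)) (map⁺ κ (↭-sym r)))) perm))
    close-up {a} {b} {d} {xs} {f} {fs} W cl perm lf sb | inj₂ free = finish (scan (κ d ∷ xs) xs os)
      where
      P K : Bool → ℕ
      P s = count (onV (eqᵇ s ∘ side)) xs
      K s = count (eqᵇ s ∘ side) os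
      size : ∀ s → n ≡ P s + K s
      size s = Eq.trans (sym (side-size s)) (sizes {κ d ∷ xs} {os} {f ∷ fs} perm (eqᵇ s ∘ side))
      P-flip : P (side a) ≡ P (not (side a))
      P-flip = suc-injective (Eq.trans (+-comm 1 _) (Eq.trans (cong (λ b → P (side a) + # b) (sym (eqᵇ-≡ (sym sb))))
        (Eq.trans (balance W (side a)) (cong (λ b → # b + P (not (side a))) (eqᵇ-refl (side a))))))
      P-any : ∀ s → P s ≡ P (side a)
      P-any s with s | side a | P-flip
      ... | true  | true  | _ = refl
      ... | false | false | _ = refl
      ... | true  | false | e = sym e
      ... | false | true  | e = sym e
      P≥ : h ≤ P (not (side a))
      P≥ = ≤-trans (degree f a) (≤-trans (≤-reflexive (Eq.trans (sizes {κ d ∷ xs} {os} {f ∷ fs} perm (adj f a))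
        (Eq.trans (cong (count (onV (adj f a)) xs +_) (none os (λ o∈ → free (here refl) (start∈ W) o∈))) (+-identityʳ _))))
        (count-mono xs (λ {i} _ → opposite f a {i})))
      one : ∀ qs → length qs ≡ suc (suc k) → ∃ λ q → q ∈ qs
      one (q ∷ _) _ = q , here refl
      o : V
      o = proj₁ (one os lo)
      o∈ : o ∈ os
      o∈ = proj₂ (one os lo)
      K≥ : h ≤ K (not (side o))
      K≥ = ≤-trans (degree f o) (≤-trans (≤-reflexive (Eq.trans (sizes {κ d ∷ xs} {os} {f ∷ fs} perm (adj f o))
        (cong (_+ count (adj f o) os) (none xs λ { {ι z} z∈ → Eq.trans (adj-sym f o z) (free (here refl) z∈ o∈) ; {κ _} _ → refl }))))
        (count-mono os (λ {q} _ e → eqᵇ-≡ (sym (adj-side f o q e)))))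
      P≡ : ∀ s → P s ≡ h
      P≡ s = ≤-antisym
        (+-cancelʳ-≤ h _ _ (≤-trans (+-mono-≤ (≤-reflexive (Eq.trans (P-any s) (sym (P-any (not (side o)))))) K≥)
          (≤-trans (≤-reflexive (sym (size (not (side o))))) n≤2h)))
        (≤-trans P≥ (≤-reflexive (Eq.trans (P-any (not (side a))) (sym (P-any s)))))
      n≡ : n ≡ h + h
      n≡ = ≤-antisym n≤2h (≤-trans (+-mono-≤ (≤-reflexive (sym (P≡ (not (side o))))) K≥) (≤-reflexive (sym (size (not (side o))))))
      K≡ : ∀ s → K s ≡ h
      K≡ s = +-cancelˡ-≡ h _ _ (Eq.trans (cong (_+ K s) (sym (P≡ s))) (Eq.trans (sym (size s)) n≡))
      free′ : ∀ {g} → g ∈ f ∷ fs → ∀ {z o} → ι z ∈ xs → o ∈ os → adj g z o ≡ false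
      free′ g∈ = free (∈-map⁺ κ g∈)
      finish : _ → Win ⊎ Extremal
      finish (inj₁ (g , z , o , g∈ , z∈ , o∈ , zo)) =
        inj₁ (win-crossing W cl perm (Eq.trans lo (cong (λ m → suc (suc m)) (sym lf))) n≡ P≡ K≡ free′ g∈ z∈ o∈ zo)
      finish (inj₂ cycle-free) = inj₂ (mkExtremal (κ d ∷ xs) os (f ∷ fs) perm n≡ P≡ K≡ apart)
        where
        apart : ∀ g {z o} → ι z ∈ κ d ∷ xs → o ∈ os → adj g z o ≡ false
        apart g (there z∈) o∈ with ∈-++⁻ (κ d ∷ xs) (∈-resp-↭ (↭-sym perm) (every-colour g))
        ... | inj₁ g∈ = cycle-free g∈ z∈ o∈
        ... | inj₂ g∈ with ∈-++⁻ (ιs os) g∈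
        ...   | inj₂ g∈′ = free g∈′ z∈ o∈
        ...   | inj₁ g∈′ with () ← proj₂ (proj₂ (∈-map⁻ ι g∈′))

    surplus : side v ≡ σ → Y′ ≡ suc X′
    surplus sv = +-cancelˡ-≡ Y _ _ (Eq.trans (sym sizeY) (Eq.trans sizeX (Eq.trans (cong (_+ X′) X≡) (sym (+-suc Y X′)))))
      where X≡ : X ≡ suc Y
            X≡ = Eq.trans (Eq.trans (sym (+-identityʳ X)) (cong (λ b → X + # b) (sym (eqᵇ-≡not {not σ} {side v} (Eq.trans sv (sym (not-involutive σ))))))) bal

    degU : count (adj a u) os ≡ 0 → h ≤ count (onV (adj a u)) xs
    degU lost = ≤-trans (degree a u) (≤-reflexive (Eq.trans (sizes′ (adj a u))
      (Eq.trans (cong (count (onV (adj a u)) xs +_) lost) (+-identityʳ _))))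

    -- The ends are on the same side, so their neighbourhoods cannot cross. An unvisited `y` on the
    -- other side replaces `v`: at most X′ of its neighbours are off the path, and the surplus Y′ =
    -- X′ + 1 makes those on the path cross the neighbours of `u`.
    even : side v ≡ σ → count (adj a u) os ≡ 0 → Win ⊎ Extremal
    even sv lost with pick! (eqᵇ (not σ) ∘ side) os (≤-trans (s≤s z≤n) (≤-reflexive (sym (surplus sv))))
    ... | y , os′ , p , sy with adj b y v in yv
    ...   | true = onward os′ (a ∷ fs) (join b (path (end y)) yv (rev (path W))) (shorter p) (suc-injective lf) (within p
              (Bag.solve 6 (λ xs y os a b fs → (b Bag.⊕ (y Bag.⊕ xs)) Bag.⊕ (os Bag.⊕ (a Bag.⊕ fs)) Bag.⊜ xs Bag.⊕ ((y Bag.⊕ os) Bag.⊕ (a Bag.⊕ (b Bag.⊕ fs)))) ↭-refl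
                xs [ ι y ] (ιs os′) [ κ a ] [ κ b ] (κs fs)))
    ...   | false with cross W (adj a u) (adj b y) (not σ) (λ q e → adj-side a u q e) (λ q e → Eq.trans (adj-side b y q e) (cong not (sym (eqᵇ⇒≡ sy))))
    ...     | inj₁ (e , e∈ , uq , yp) = found (split W e∈)
      where
      found : Split W e → Win ⊎ Extremal
      found (mkSplit {as} {bs} W₁ _ W₂ refl _) = onward os′ (colour e ∷ fs) (join b (path (end y)) yp (join a (rev (path W₁)) uq (path W₂)))
        (shorter p) (suc-injective lf) (within p
          (Bag.solve 8 (λ as k bs y os a b fs → (b Bag.⊕ (y Bag.⊕ (a Bag.⊕ (as Bag.⊕ bs)))) Bag.⊕ (os Bag.⊕ (k Bag.⊕ fs)) Bag.⊜ (as Bag.⊕ (k Bag.⊕ bs)) Bag.⊕ ((y Bag.⊕ os) Bag.⊕ (a Bag.⊕ (b Bag.⊕ fs))))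
            ↭-refl as [ κ (colour e) ] bs [ ι y ] (ιs os′) [ κ a ] [ κ b ] (κs fs)))
    ...     | inj₂ (le , _) = ⊥-elim (1+n≰n (begin
        suc (Y + X′)     ≡⟨ sym (Eq.trans sizeY (Eq.trans (cong (Y +_) (surplus sv)) (+-suc Y X′))) ⟩
        n                ≤⟨ n≤2h ⟩
        h + h            ≤⟨ +-mono-≤ (degU lost) G≥ ⟩
        F + (G + X′)     ≡⟨ sym (+-assoc F G X′) ⟩
        F + G + X′       ≤⟨ +-monoˡ-≤ X′ (subst₂ _≤_ left right le) ⟩
        Y + X′           ∎))
      where
      open ≤-Reasoning
      F = count (onV (adj a u)) xs
      G = count (onV (adj b y)) xs
      left : F + G + # (eqᵇ (not σ) (side u)) ≡ F + G
      left = Eq.trans (cong (λ b → F + G + # b) (eqᵇ-≡not {not σ} {side u} (sym (not-involutive σ)))) (+-identityʳ _)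
      right : Y + (# (adj a u u) + # (adj b y v)) ≡ Y
      right = Eq.trans (cong₂ (λ a b → Y + (# a + # b)) (no-loop {a} {u}) yv) (+-identityʳ _)
      G≥ : h ≤ G + X′
      G≥ = ≤-trans (degree b y) (≤-trans (≤-reflexive (sizes′ (adj b y))) (+-monoʳ-≤ G
        (count-mono os (λ {q} _ e → eqᵇ-≡ (sym (Eq.trans (adj-side b y q e) (Eq.trans (cong not (sym (eqᵇ⇒≡ sy))) (not-involutive σ))))))))

    -- If neither end can be extended, both neighbourhoods lie on the path. They have n or more
    -- members together, while some vertex on the side opposite to `u` is unvisited; so they cross
    -- and the path closes up.
    odd : side v ≡ not σ → count (adj a u) os ≡ 0 → Win ⊎ Extremal
    odd sv lost with pick (adj b v) os
    ... | inj₁ (o , os′ , p , vo) = onward os′ (a ∷ fs) (join b (path W) vo (path (end o))) (shorter p) (suc-injective lf) (within p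
          (Bag.solve 6 (λ xs y os a b fs → (b Bag.⊕ (xs Bag.⊕ y)) Bag.⊕ (os Bag.⊕ (a Bag.⊕ fs)) Bag.⊜ xs Bag.⊕ ((y Bag.⊕ os) Bag.⊕ (a Bag.⊕ (b Bag.⊕ fs)))) ↭-refl
            xs [ ι o ] (ιs os′) [ κ a ] [ κ b ] (κs fs)))
    ... | inj₂ lost′ with cross W (adj a u) (adj b v) (not σ) (λ q e → adj-side a u q e) (λ q e → Eq.trans (adj-side b v q e) (cong not sv))
    ...   | inj₁ (e , e∈ , uq , vp) = found (split W e∈)
      where
      found : Split W e → Win ⊎ Extremal
      found (mkSplit {as} {bs} W₁ _ W₂ refl _) with join a (rev (path W₁)) uq (path W₂)
      ... | _ , W′ , r = close-up W′ vp
        (↭-trans (prep _ (++⁺ʳ (ιs os ++ κs (colour e ∷ fs)) r)) (↭-trans (Bag.solve 7 (λ as k bs os a b fs →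
            b Bag.⊕ ((a Bag.⊕ (as Bag.⊕ bs)) Bag.⊕ (os Bag.⊕ (k Bag.⊕ fs))) Bag.⊜ (as Bag.⊕ (k Bag.⊕ bs)) Bag.⊕ (os Bag.⊕ (a Bag.⊕ (b Bag.⊕ fs))))
            ↭-refl as [ κ (colour e) ] bs (ιs os) [ κ a ] [ κ b ] (κs fs)) perm))
        (suc-injective (suc-injective lf)) (not-flip (adj-side b v (tail e) vp))
    ...   | inj₂ (le , _) = ⊥-elim (1+n≰n (begin
        suc Y            ≡⟨ sym (+-comm Y 1) ⟩
        Y + 1            ≤⟨ +-monoʳ-≤ Y (some os lo) ⟩
        Y + Y′           ≡⟨ sym sizeY ⟩
        n                ≤⟨ n≤2h ⟩
        h + h            ≤⟨ +-mono-≤ (degU lost) G≥ ⟩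
        F + G            ≤⟨ subst₂ _≤_ left right le ⟩
        Y                ∎))
      where
      open ≤-Reasoning
      F = count (onV (adj a u)) xs
      G = count (onV (adj b v)) xs
      left : F + G + # (eqᵇ (not σ) (side u)) ≡ F + G
      left = Eq.trans (cong (λ b → F + G + # b) (eqᵇ-≡not {not σ} {side u} (sym (not-involutive σ)))) (+-identityʳ _)
      right : Y + (# (adj a u u) + # (adj b v v)) ≡ Y
      right = Eq.trans (cong₂ (λ a b → Y + (# a + # b)) (no-loop {a} {u}) (no-loop {b} {v})) (+-identityʳ _)
      G≥ : h ≤ G
      G≥ = ≤-trans (degree b v) (≤-reflexive (Eq.trans (sizes′ (adj b v)) (Eq.trans (cong (G +_) lost′) (+-identityʳ _))))
      X≡Y : X ≡ Y
      X≡Y = suc-injective (Eq.trans (+-comm 1 X) (Eq.trans (cong (λ b → X + # b) (sym (eqᵇ-≡ (sym sv)))) bal))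
      X′≡Y′ : X′ ≡ Y′
      X′≡Y′ = +-cancelˡ-≡ Y _ _ (Eq.trans (Eq.trans (cong (_+ X′) (sym X≡Y)) (sym sizeX)) sizeY)
      some : ∀ qs → length qs ≡ suc (suc k) → 1 ≤ Y′
      some _ _ with pick (eqᵇ (not σ) ∘ side) os
      ... | inj₁ (_ , _ , p , e) = count-∈ (eqᵇ (not σ) ∘ side) (∈-resp-↭ (↭-sym p) (here refl)) e
      ... | inj₂ none-Y = ⊥-elim (nonempty os lo (Eq.trans X′≡Y′ none-Y) none-Y)
        where
        nonempty : ∀ qs → length qs ≡ suc (suc k) → count (eqᵇ σ ∘ side) qs ≡ 0 → count (eqᵇ (not σ) ∘ side) qs ≡ 0 → ⊥
        nonempty (q ∷ qs) _ e₁ e₂ with which-side σ q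
        ... | inj₁ s = true≢false (eqᵇ-≡ (sym s)) (vanish {xs = q ∷ qs} e₁ (here refl))
        ... | inj₂ s = true≢false (eqᵇ-≡ (sym s)) (vanish {xs = q ∷ qs} e₂ (here refl))

    ends : (∃ λ o → ∃ λ os′ → os ↭ o ∷ os′ × adj a u o ≡ true) ⊎ count (adj a u) os ≡ 0 → side v ≡ σ ⊎ side v ≡ not σ → Win ⊎ Extremal
    ends (inj₁ (o , os′ , p , uo)) _ = onward os′ (b ∷ fs) (join a (path (end o)) (adj′ uo) (path W)) (shorter p) (suc-injective lf) (within p
      (Bag.solve 6 (λ xs y os a b fs → (a Bag.⊕ (y Bag.⊕ xs)) Bag.⊕ (os Bag.⊕ (b Bag.⊕ fs)) Bag.⊜ xs Bag.⊕ ((y Bag.⊕ os) Bag.⊕ (a Bag.⊕ (b Bag.⊕ fs)))) ↭-refl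
        xs [ ι o ] (ιs os′) [ κ a ] [ κ b ] (κs fs)))
    ends (inj₂ lost) (inj₁ sv) = even sv lost
    ends (inj₂ lost) (inj₂ sv) = odd sv lost

  build : ∀ k → Buildable k
  build zero [] [] _ _ W perm = inj₁ (win (path W) (↭-trans (↭-reflexive (sym (++-identityʳ _))) perm))
  -- Only one colour is left, so `grow` no longer applies. The sides are forced: a path on 2n - 1
  -- vertices has both ends on the larger side, and `y` is on the other.
  build (suc zero) {u} {v} {xs} (y ∷ []) (c ∷ []) _ _ W perm = inj₁ ends
    where
    σ = side u
    X Y : ℕ
    X = count (onV (eqᵇ σ ∘ side)) xs
    Y = count (onV (eqᵇ (not σ) ∘ side)) xs
    sizeX : n ≡ X + (# (eqᵇ σ (side y)) + 0)
    sizeX = Eq.trans (sym (side-size σ)) (sizes {xs} {y ∷ []} {c ∷ []} perm (eqᵇ σ ∘ side))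
    sizeY : n ≡ Y + (# (eqᵇ (not σ) (side y)) + 0)
    sizeY = Eq.trans (sym (side-size (not σ))) (sizes {xs} {y ∷ []} {c ∷ []} perm (eqᵇ (not σ) ∘ side))
    bal : X + # (eqᵇ (not σ) (side v)) ≡ suc Y
    bal = Eq.trans (balance W σ) (cong (λ b → # b + Y) (eqᵇ-refl σ))
    perm′ : ι y ∷ κ c ∷ xs ↭ Stock
    perm′ = ↭-trans (Bag.solve 3 (λ y c xs → y Bag.⊕ (c Bag.⊕ xs) Bag.⊜ xs Bag.⊕ (y Bag.⊕ c)) ↭-refl [ ι y ] [ κ c ] xs) perm
    opposite-y : side v ≡ σ → side y ≡ σ → ⊥
    opposite-y sv sy′ = 1+n≰n (≤-trans (≤-reflexive (sym Y≡)) (m≤m+n Y 1 ⟨≤⟩ ≤-reflexive (Eq.trans (+-comm Y 1) (sym X≡))))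
      where
      _⟨≤⟩_ = ≤-trans
      X≡ : X ≡ suc Y
      X≡ = Eq.trans (Eq.trans (sym (+-identityʳ X)) (cong (λ b → X + # b) (sym (eqᵇ-≡not (Eq.trans sv (sym (not-involutive σ))))))) bal
      Y≡ : Y ≡ suc X
      Y≡ = Eq.trans (Eq.trans (sym (+-identityʳ Y)) (cong (λ b → Y + (# b + 0)) (sym (eqᵇ-≡not (Eq.trans sy′ (sym (not-involutive σ)))))))
        (Eq.trans (Eq.trans (sym sizeY) sizeX) (Eq.trans (cong (λ b → X + (# b + 0)) (eqᵇ-≡ (sym sy′))) (+-comm X 1)))
    differ : side v ≡ not σ → ⊥
    differ sv = clash (which-side σ y)
      where
      X≡Y : X ≡ Y
      X≡Y = suc-injective (Eq.trans (+-comm 1 X) (Eq.trans (cong (λ b → X + # b) (sym (eqᵇ-≡ (sym sv)))) bal))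
      eq : X + (# (eqᵇ σ (side y)) + 0) ≡ X + (# (eqᵇ (not σ) (side y)) + 0)
      eq = Eq.trans (Eq.trans (sym sizeX) sizeY) (cong (_+ (# (eqᵇ (not σ) (side y)) + 0)) (sym X≡Y))
      clash : side y ≡ σ ⊎ side y ≡ not σ → ⊥
      clash (inj₁ s) with () ← Eq.trans (sym (cong (λ b → # b + 0) (eqᵇ-≡ {σ} {side y} (sym s)))) (Eq.trans (+-cancelˡ-≡ X _ _ eq)
        (cong (λ b → # b + 0) (eqᵇ-≡not {not σ} {side y} (Eq.trans s (sym (not-involutive σ))))))
      clash (inj₂ s) with () ← Eq.trans (sym (cong (λ b → # b + 0) (eqᵇ-≡not {σ} {side y} s))) (Eq.trans (+-cancelˡ-≡ X _ _ eq)
        (cong (λ b → # b + 0) (eqᵇ-≡ {not σ} {side y} (sym s))))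
    ends : Win
    ends with which-side σ v | which-side σ y
    ... | inj₁ sv | inj₂ sy = win-last W perm′ sy sv
    ... | inj₁ sv | inj₁ sy = ⊥-elim (opposite-y sv sy)
    ... | inj₂ sv | _       = ⊥-elim (differ sv)
  build (suc (suc k)) = grow k (build (suc k))

-- The concrete graphs: stocking the bag, and reading off the transversal or the extremal structure.

count-tabulate : ∀ {A : Set} {n} (p : A → Bool) (f : Fin n → A) → count p (tabulate f) ≡ countTrue (p ∘ f)
count-tabulate {n = zero}  p f = refl
count-tabulate {n = suc n} p f with p (f zero)
... | true  = cong suc (count-tabulate p (f ∘ suc))
... | false = count-tabulate p (f ∘ suc)

_==_ : ∀ {n} → Fin n → Fin n → Bool
x == y = does (x Fin.≟ y)

==-refl : ∀ {n} (x : Fin n) → (x == x) ≡ true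
==-refl x = dec-true (x Fin.≟ x) refl

==⇒≡ : ∀ {n} {x y : Fin n} → (x == y) ≡ true → x ≡ y
==⇒≡ {x = x} {y} e with x Fin.≟ y
... | yes eq = eq
==⇒≡ () | no _

count-== : ∀ {n} (x : Fin n) → countTrue (x ==_) ≡ 1
count-== {suc n} zero = cong suc (zeros n)
  where zeros : ∀ n → countTrue {n} (λ _ → false) ≡ 0
        zeros zero    = refl
        zeros (suc n) = zeros n
count-== (suc x) = count-== x

==-sym : ∀ {n} (x y : Fin n) → (x == y) ≡ (y == x)
==-sym x y with x == y in a | y == x in b
... | true  | true  = refl
... | false | false = refl
... | true  | false with refl ← ==⇒≡ {x = x} {y} a = ⊥-elim (true≢false (==-refl x) b)
... | false | true  with refl ← ==⇒≡ {x = y} {x} b = ⊥-elim (true≢false (==-refl x) a)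

module Main {n N} (1≤n : 1 ≤ n) (N≡ : suc N ≡ n + n) (G : Fin N → BipGraph n)
  (δ : ∀ i → MinDegAtLeast (G i) ⌈ n /2⌉) where

  V : Set
  V = Vertex n

  side : V → Bool
  side (inj₁ _) = true
  side (inj₂ _) = false

  adj : Fin N → V → V → Bool
  adj c = Adj (G c)

  adj-sym : ∀ c u v → adj c u v ≡ adj c v u
  adj-sym c (inj₁ _) (inj₁ _) = refl
  adj-sym c (inj₁ _) (inj₂ _) = refl
  adj-sym c (inj₂ _) (inj₁ _) = refl
  adj-sym c (inj₂ _) (inj₂ _) = refl

  adj-side : ∀ c u v → adj c u v ≡ true → side v ≡ not (side u)
  adj-side c (inj₁ _) (inj₂ _) _ = refl
  adj-side c (inj₂ _) (inj₁ _) _ = refl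

  open Walks side adj adj-sym adj-side

  vertices : List V
  vertices = map inj₁ (allFin n) ++ map inj₂ (allFin n)

  Stock : List Item
  Stock = map ι vertices ++ map κ (allFin N)

  count-map : ∀ {A B : Set} (f : B → Bool) (g : A → B) xs → count f (map g xs) ≡ count (f ∘ g) xs
  count-map f g []       = refl
  count-map f g (x ∷ xs) = cong (# (f (g x)) +_) (count-map f g xs)

  count-fin : ∀ {m} (f : Fin m → Bool) → count f (allFin m) ≡ countTrue f
  count-fin f = count-tabulate f (λ i → i)

  count-Stock : ∀ f → count (onV f) Stock ≡ countTrue (f ∘ inj₁) + countTrue (f ∘ inj₂)
  count-Stock f = begin
    count (onV f) Stock                                                   ≡⟨ count-++ (onV f) (map ι vertices) _ ⟩
    count (onV f) (map ι vertices) + count (onV f) (map κ (allFin N))   ≡⟨ cong₂ _+_ (count-map (onV f) ι vertices) (Eq.trans (count-map (onV f) κ (allFin N)) (count-zero (λ _ → refl) (allFin N))) ⟩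
    count f vertices + 0                                                ≡⟨ +-identityʳ _ ⟩
    count f vertices                                                    ≡⟨ count-++ f (map inj₁ (allFin n)) _ ⟩
    count f (map inj₁ (allFin n)) + count f (map inj₂ (allFin n))       ≡⟨ cong₂ _+_ (Eq.trans (count-map f inj₁ (allFin n)) (count-fin (f ∘ inj₁))) (Eq.trans (count-map f inj₂ (allFin n)) (count-fin (f ∘ inj₂))) ⟩
    countTrue (f ∘ inj₁) + countTrue (f ∘ inj₂)                         ∎
    where open ≡-Reasoning

  count-colour : ∀ f → count (onC f) Stock ≡ countTrue f
  count-colour f = Eq.trans (count-++ (onC f) (map ι vertices) _) (Eq.trans
    (cong₂ _+_ (Eq.trans (count-map (onC f) ι vertices) (count-zero (λ _ → refl) vertices)) (count-map (onC f) κ (allFin N)))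
    (count-fin f))

  countTrue-true : ∀ m → countTrue {m} (λ _ → true) ≡ m
  countTrue-true zero    = refl
  countTrue-true (suc m) = cong suc (countTrue-true m)

  countTrue-false : ∀ m → countTrue {m} (λ _ → false) ≡ 0
  countTrue-false zero    = refl
  countTrue-false (suc m) = countTrue-false m

  h : ℕ
  h = ⌈ n /2⌉

  n≤2h : n ≤ h + h
  n≤2h = ≤-trans (≤-reflexive (sym (⌊n/2⌋+⌈n/2⌉≡n n))) (+-monoˡ-≤ h (⌊n/2⌋≤⌈n/2⌉ n))

  side-size : ∀ s → count (onV (eqᵇ s ∘ side)) Stock ≡ n
  side-size true  = Eq.trans (count-Stock _) (Eq.trans (cong₂ _+_ (countTrue-true n) (countTrue-false n)) (+-identityʳ n))
  side-size false = Eq.trans (count-Stock _) (cong₂ _+_ (countTrue-false n) (countTrue-true n))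

  colours-size : suc (count (onC (λ _ → true)) Stock) ≡ n + n
  colours-size = Eq.trans (cong suc (Eq.trans (count-colour (λ _ → true)) (countTrue-true N))) N≡

  degree : ∀ c v → h ≤ count (onV (adj c v)) Stock
  degree c (inj₁ x) = ≤-trans (proj₁ (δ c) x) (≤-reflexive (sym (Eq.trans (count-Stock (adj c (inj₁ x))) (cong (_+ degX (G c) x) (countTrue-false n)))))
  degree c (inj₂ y) = ≤-trans (proj₂ (δ c) y) (≤-reflexive (sym (Eq.trans (count-Stock (adj c (inj₂ y)))
    (Eq.trans (cong (degY (G c) y +_) (countTrue-false n)) (+-identityʳ _)))))

  _≐_ : V → V → Bool
  inj₁ x ≐ inj₁ y = x == y
  inj₂ x ≐ inj₂ y = x == y
  _      ≐ _      = false

  ≐-refl : ∀ v → (v ≐ v) ≡ true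
  ≐-refl (inj₁ x) = ==-refl x
  ≐-refl (inj₂ x) = ==-refl x

  ≐⇒≡ : ∀ {u v} → (u ≐ v) ≡ true → u ≡ v
  ≐⇒≡ {inj₁ x} {inj₁ y} e = cong inj₁ (==⇒≡ {x = x} {y} e)
  ≐⇒≡ {inj₂ x} {inj₂ y} e = cong inj₂ (==⇒≡ {x = x} {y} e)

  vertex-once : ∀ v → count (onV (v ≐_)) Stock ≡ 1
  vertex-once (inj₁ x) = Eq.trans (count-Stock (inj₁ x ≐_)) (cong₂ _+_ (count-== x) (countTrue-false n))
  vertex-once (inj₂ y) = Eq.trans (count-Stock (inj₂ y ≐_)) (cong₂ _+_ (countTrue-false n) (count-== y))

  distinct : ∀ {z rest} → Stock ↭ ι z ∷ ι z ∷ rest → ⊥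
  distinct {z} {rest} p = 1+n≰n (≤-trans (s≤s (s≤s z≤n)) (≤-reflexive (Eq.trans
    (sym (Eq.trans (count-↭ (onV (z ≐_)) p) (cong₂ (λ a b → # a + (# b + count (onV (z ≐_)) rest)) (≐-refl z) (≐-refl z)))) (vertex-once z))))

  every-colour : ∀ c → κ c ∈ Stock
  every-colour c = ∈-++⁺ʳ (map ι vertices) (∈-map⁺ κ (∈-allFin c))

  open Setting side adj adj-sym adj-side Stock n h n≤2h side-size colours-size degree distinct 1≤n every-colour
    using (Win; Extremal; mkExtremal; build; count-parts; complete-in; complete-out)

  -- Generalised over the length because the size of a walk equals `N` only propositionally;
  -- `transversal` transports along that equation.
  Transversal : ℕ → Set
  Transversal ℓ = Σ (Fin (suc ℓ) → V) λ v → Σ (Fin ℓ → Fin N) λ φ →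
    Injective _≡_ _≡_ v × (∀ w → ∃ λ j → v j ≡ w) × Injective _≡_ _≡_ φ ×
    (∀ i → adj (φ i) (v (inject₁ i)) (v (suc i)) ≡ true)

  size : ∀ {u v xs} → Walk u v xs → ℕ
  size (end _)        = 0
  size (step _ _ _ W) = suc (size W)

  vertexAt : ∀ {u v xs} (W : Walk u v xs) → Fin (suc (size W)) → V
  vertexAt (end v)        zero    = v
  vertexAt (step u k a W) zero    = u
  vertexAt (step u k a W) (suc i) = vertexAt W i

  colourAt : ∀ {u v xs} (W : Walk u v xs) → Fin (size W) → Fin N
  colourAt (step u k a W) zero    = k
  colourAt (step u k a W) (suc i) = colourAt W i

  vertexAt-zero : ∀ {u v xs} (W : Walk u v xs) → vertexAt W zero ≡ u
  vertexAt-zero (end _)        = refl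
  vertexAt-zero (step _ _ _ _) = refl

  size-colours : ∀ {u v xs} (W : Walk u v xs) → size W ≡ count (onC (λ _ → true)) xs
  size-colours (end _)        = refl
  size-colours (step _ _ _ W) = cong suc (size-colours W)

  vertexAt∈ : ∀ {u v xs} (W : Walk u v xs) i → ι (vertexAt W i) ∈ xs
  vertexAt∈ (end v)        zero    = here refl
  vertexAt∈ (step u k a W) zero    = here refl
  vertexAt∈ (step u k a W) (suc i) = there (there (vertexAt∈ W i))

  colourAt∈ : ∀ {u v xs} (W : Walk u v xs) i → κ (colourAt W i) ∈ xs
  colourAt∈ (step u k a W) zero    = there (here refl)
  colourAt∈ (step u k a W) (suc i) = there (there (colourAt∈ W i))

  consecutive : ∀ {u v xs} (W : Walk u v xs) i → adj (colourAt W i) (vertexAt W (inject₁ i)) (vertexAt W (suc i)) ≡ true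
  consecutive (step u k a W) zero    rewrite vertexAt-zero W = a
  consecutive (step u k a W) (suc i) = consecutive W i

  onto : ∀ {u v xs w} (W : Walk u v xs) → ι w ∈ xs → ∃ λ i → vertexAt W i ≡ w
  onto (end v)        (here refl)         = zero , refl
  onto (step u k a W) (here refl)         = zero , refl
  onto (step u k a W) (there (there w∈))  = let i , eq = onto W w∈ in suc i , eq

  twice : ∀ {A : Set} (f : A → Bool) {x y xs} → f x ≡ true → f y ≡ true → y ∈ xs → 2 ≤ # (f x) + count f xs
  twice f fx fy y∈ rewrite fx = s≤s (count-∈ f y∈ fy)

  vertexAt-injective : ∀ {u v xs} (W : Walk u v xs) → (∀ w → count (onV (w ≐_)) xs ≤ 1) → ∀ i j → vertexAt W i ≡ vertexAt W j → i ≡ j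
  vertexAt-injective (end _)        _    zero    zero    _  = refl
  vertexAt-injective (step u k a W) once zero    zero    _  = refl
  vertexAt-injective (step u k a W) once zero    (suc j) eq = ⊥-elim (1+n≰n (≤-trans
    (twice (onV (u ≐_)) {ι u} (≐-refl u) (Eq.trans (cong (u ≐_) (sym eq)) (≐-refl u)) (vertexAt∈ W j)) (once u)))
  vertexAt-injective (step u k a W) once (suc i) zero    eq = sym (vertexAt-injective (step u k a W) once zero (suc i) (sym eq))
  vertexAt-injective (step u k a W) once (suc i) (suc j) eq =
    cong suc (vertexAt-injective W (λ w → ≤-trans (m≤n+m _ _) (once w)) i j eq)

  colourAt-injective : ∀ {u v xs} (W : Walk u v xs) → (∀ c → count (onC (c ==_)) xs ≤ 1) → ∀ i j → colourAt W i ≡ colourAt W j → i ≡ j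
  colourAt-injective (step u k a W) once zero    zero    _  = refl
  colourAt-injective (step u k a W) once zero    (suc j) eq = ⊥-elim (1+n≰n (≤-trans
    (twice (onC (k ==_)) {κ k} (==-refl k) (Eq.trans (cong (k ==_) (sym eq)) (==-refl k)) (colourAt∈ W j)) (once k)))
  colourAt-injective (step u k a W) once (suc i) zero    eq = sym (colourAt-injective (step u k a W) once zero (suc i) (sym eq))
  colourAt-injective (step u k a W) once (suc i) (suc j) eq = 
    cong suc (colourAt-injective W (λ c → ≤-trans (m≤n+m _ _) (once c)) i j eq)

  transversal : Win → HamPathTransversal G
  transversal (u , v , xs , W , p) = subst Transversal
    (Eq.trans (size-colours W) (Eq.trans (count-↭ (onC (λ _ → true)) p) (Eq.trans (count-colour (λ _ → true)) (countTrue-true N))))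
    ( vertexAt W , colourAt W
    , (λ {i} {j} → vertexAt-injective W (λ w → ≤-reflexive (Eq.trans (count-↭ (onV (w ≐_)) p) (vertex-once w))) i j)
    , (λ w → onto W (present w))
    , (λ {i} {j} → colourAt-injective W (λ c → ≤-reflexive (Eq.trans (count-↭ (onC (c ==_)) p) (Eq.trans (count-colour (c ==_)) (count-== c)))) i j)
    , consecutive W )
    where
    present : ∀ w → ι w ∈ xs
    present w with count-pos (onV (w ≐_)) xs (≤-reflexive (sym (Eq.trans (count-↭ (onV (w ≐_)) p) (vertex-once w))))
    ... | ι w′ , w∈ , e with refl ← ≐⇒≡ {w} {w′} e = w∈

  extremal : Extremal → (2 ∣ n) × AllExtremal G
  extremal (mkExtremal xs os fs perm n≡ half-in half-out apart) =
    divides h (Eq.trans n≡ double) , (λ x → member (inj₁ x)) , (λ y → member (inj₂ y)) ,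
      Eq.trans (members inj₁ true pointwise₁) half , Eq.trans (members inj₂ false pointwise₂) half , agrees
    where
    double : h + h ≡ h * 2
    double = Eq.trans (cong (h +_) (sym (+-identityʳ h))) (*-comm 2 h)
    half : h ≡ n / 2
    half = sym (Eq.trans (cong (_/ 2) (Eq.trans n≡ double)) (m*n/n≡m h 2))
    positive : ℕ → Bool
    positive zero    = false
    positive (suc _) = true
    -- Membership has to be a Boolean, so it is read off from the multiplicity in the bag, which
    -- `total` bounds by one.
    member : V → Bool
    member v = positive (count (onV (v ≐_)) xs)
    total : ∀ v → count (onV (v ≐_)) xs + count (v ≐_) os ≡ 1
    total v = Eq.trans (sym (count-parts (v ≐_) xs os fs)) (Eq.trans (count-↭ (onV (v ≐_)) perm) (vertex-once v))
    member-# : ∀ v → # (member v) ≡ count (onV (v ≐_)) xs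
    member-# v with count (onV (v ≐_)) xs | total v
    ... | zero        | _  = refl
    ... | suc zero    | _  = refl
    ... | suc (suc _) | ()
    inside : ∀ v → member v ≡ true → ι v ∈ xs
    inside v e with count-pos (onV (v ≐_)) xs (≤-trans (≤-reflexive (cong # (sym e))) (≤-reflexive (member-# v)))
    ... | ι w , w∈ , eq with refl ← ≐⇒≡ {v} {w} eq = w∈
    outside : ∀ v → member v ≡ false → v ∈ os
    outside v e with count-pos (v ≐_) os (≤-reflexive (sym (Eq.trans (cong (_+ count (v ≐_) os) (Eq.trans (cong # (sym e)) (member-# v))) (total v))))
    ... | w , w∈ , eq with refl ← ≐⇒≡ {v} {w} eq = w∈
    pointwise₁ : ∀ i → count (λ x → onV (inj₁ x ≐_) i) (allFin n) ≡ # (onV (eqᵇ true ∘ side) i)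
    pointwise₁ (ι (inj₁ z)) = Eq.trans (count-cong (λ x → ==-sym x z) (allFin n)) (Eq.trans (count-fin (z ==_)) (count-== z))
    pointwise₁ (ι (inj₂ z)) = count-zero (λ _ → refl) (allFin n)
    pointwise₁ (κ _)        = count-zero (λ _ → refl) (allFin n)
    pointwise₂ : ∀ i → count (λ x → onV (inj₂ x ≐_) i) (allFin n) ≡ # (onV (eqᵇ false ∘ side) i)
    pointwise₂ (ι (inj₂ z)) = Eq.trans (count-cong (λ x → ==-sym x z) (allFin n)) (Eq.trans (count-fin (z ==_)) (count-== z))
    pointwise₂ (ι (inj₁ z)) = count-zero (λ _ → refl) (allFin n)
    pointwise₂ (κ _)        = count-zero (λ _ → refl) (allFin n)
    sumBy-cong : ∀ {A : Set} {f g : A → ℕ} → (∀ x → f x ≡ g x) → ∀ xs → sumBy f xs ≡ sumBy g xs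
    sumBy-cong eq []       = refl
    sumBy-cong eq (x ∷ xs) = cong₂ _+_ (eq x) (sumBy-cong eq xs)
    -- Double counting of the pairs of a vertex `inj x` and an equal item of the bag: each item on
    -- side `s` equals exactly one such vertex, every other item none.
    members : ∀ (inj : Fin n → V) s →
      (∀ i → count (λ x → onV (inj x ≐_) i) (allFin n) ≡ # (onV (eqᵇ s ∘ side) i)) → countTrue (λ x → member (inj x)) ≡ h
    members inj s pointwise = begin
      countTrue (λ x → member (inj x))                              ≡⟨ sym (count-fin (λ x → member (inj x))) ⟩
      count (λ x → member (inj x)) (allFin n)                       ≡⟨ sym (sumBy-# (λ x → member (inj x)) (allFin n)) ⟩
      sumBy (λ x → # (member (inj x))) (allFin n)                   ≡⟨ sumBy-cong (λ x → member-# (inj x)) (allFin n) ⟩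
      sumBy (λ x → count (onV (inj x ≐_)) xs) (allFin n)            ≡⟨ sumBy-swap (λ x → onV (inj x ≐_)) (allFin n) xs ⟩
      sumBy (λ i → count (λ x → onV (inj x ≐_) i) (allFin n)) xs    ≡⟨ sumBy-cong pointwise xs ⟩
      sumBy (# ∘ onV (eqᵇ s ∘ side)) xs                             ≡⟨ sumBy-# (onV (eqᵇ s ∘ side)) xs ⟩
      count (onV (eqᵇ s ∘ side)) xs                                 ≡⟨ half-in s ⟩
      h                                                             ∎
      where open ≡-Reasoning
    agrees : ∀ i x y → G i x y ≡ eqᵇ (member (inj₁ x)) (member (inj₂ y))
    agrees i x y with member (inj₁ x) in a | member (inj₂ y) in b
    ... | true  | true  = complete-in perm {i} {inj₁ x} {inj₂ y} (≤-reflexive (half-in false)) (λ o∈ → apart i (inside (inj₁ x) a) o∈) (inside (inj₂ y) b) refl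
    ... | true  | false = apart i {inj₁ x} {inj₂ y} (inside (inj₁ x) a) (outside (inj₂ y) b)
    ... | false | true  = apart i {inj₂ y} {inj₁ x} (inside (inj₂ y) b) (outside (inj₁ x) a)
    ... | false | false = complete-out perm {i} {inj₁ x} {inj₂ y} (≤-reflexive (half-out false)) (λ z∈ → apart i z∈ (outside (inj₁ x) a)) (outside (inj₂ y) b) refl

  vertex : V
  vertex = go 1≤n
    where go : ∀ {m} → 1 ≤ m → Fin m ⊎ Fin m
          go (s≤s _) = inj₁ zero

  vertex∈ : vertex ∈ vertices
  vertex∈ with vertex
  ... | inj₁ x = ∈-++⁺ˡ (∈-map⁺ inj₁ (∈-allFin x))
  ... | inj₂ y = ∈-++⁺ʳ _ (∈-map⁺ inj₂ (∈-allFin y))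

  conclusion : Win ⊎ Extremal
  conclusion with extract vertex∈
  ... | os , p = build N os (allFin N) (suc-injective (Eq.trans (sym (↭-length p)) number)) (length-tabulate {n = N} (λ i → i))
      (end vertex) (++⁺ʳ (map κ (allFin N)) (map⁺ ι (↭-sym p)))
    where
    part : (inj : Fin n → V) → length (map inj (allFin n)) ≡ n
    part inj = Eq.trans (length-map inj (allFin n)) (length-tabulate {n = n} (λ i → i))
    number : length vertices ≡ suc N
    number = Eq.trans (length-++ (map inj₁ (allFin n))) (Eq.trans (cong₂ _+_ (part inj₁) (part inj₂)) (sym N≡))

  result : HamPathTransversal G ⊎ ((2 ∣ n) × AllExtremal G)
  result with conclusion
  ... | inj₁ v = inj₁ (transversal v)
  ... | inj₂ e = inj₂ (extremal e)

theorem1p3 : (n : ℕ) → 1 ≤ n → (G : Fin (2 * n ∸ 1) → BipGraph n)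
    → (∀ i → MinDegAtLeast (G i) ⌈ n /2⌉)
    → HamPathTransversal G ⊎ ((2 ∣ n) × AllExtremal G)
theorem1p3 n@(suc m) 1≤n G δ = Main.result 1≤n (cong (λ k → suc (m + suc k)) (+-identityʳ m)) G δ
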